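{- There is no binary projective linear code of effective length $59$ all of whose codeword weights are divisible by $8$. Consequently, binary projective linear codes with all weights divisible by $8$ exist precisely for the effective lengths $15,16,30,31,32,45,46,47,48,49,50,51$ and all $n\ge 60$.
   Context: A binary linear code is projective if its generator matrix has no zero column and no two equal columns; its effective length is the number of coordinates that are not identically zero over the code. -}

module Defs where

open import Data.Nat using (ℕ; zero; suc; _+_; _≤_)
open import Data.Nat.Divisibility using (_∣_)
open import Data.Bool using (Bool; true; false; _∧_; _∨_; _xor_)
open import Data.Fin using (Fin; zero; suc)
open import Data.Product using (Σ; ∃; _×_; _,_)
open import Data.Sum using (_⊎_)
open import Data.List using (List; []; _∷_)
open import Data.List.Membership.Propositional using (_∈_)
open import Relation.Binary.PropositionalEquality using (_≡_; _≢_)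
open import Relation.Nullary using (¬_)

-- Binary linear codes over F₂ = Bool (addition = xor, multiplication = ∧).
-- A k × n generator matrix over F₂.
Matrix : ℕ → ℕ → Set
Matrix k n = Fin k → Fin n → Bool

⊕ : ∀ {k} → (Fin k → Bool) → Bool
⊕ {zero}  f = false
⊕ {suc k} f = f zero xor ⊕ (λ i → f (suc i))

b2n : Bool → ℕ
b2n true  = 1
b2n false = 0

count : ∀ {n} → (Fin n → Bool) → ℕ
count {zero}  f = 0
count {suc n} f = b2n (f zero) + count (λ j → f (suc j))

encode : ∀ {k n} → Matrix k n → (Fin k → Bool) → Fin n → Bool
encode G x j = ⊕ (λ i → x i ∧ G i j)

weight : ∀ {n} → (Fin n → Bool) → ℕ
weight = count

-- The rows of G are linearly independent, so G is a generator matrix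
-- (a basis) of the code {x·G}.
FullRank : ∀ {k n} → Matrix k n → Set
FullRank {k} {n} G = ∀ (x : Fin k → Bool) → (∀ j → encode G x j ≡ false) → ∀ i → x i ≡ false

column : ∀ {k n} → Matrix k n → Fin n → Fin k → Bool
column G j i = G i j

Projective : ∀ {k n} → Matrix k n → Set
Projective {k} {n} G =
  (∀ j → ¬ (∀ i → G i j ≡ false)) ×
  (∀ j j' → j ≢ j' → ¬ (∀ i → G i j ≡ G i j'))

any' : ∀ {k} → (Fin k → Bool) → Bool
any' {zero}  f = false
any' {suc k} f = f zero ∨ any' (λ i → f (suc i))

-- Coordinate j is not identically zero over the code ⇔ column j is nonzero.
NonzeroCoordinate : ∀ {k n} → Matrix k n → Fin n → Bool
NonzeroCoordinate G j = any' (λ i → G i j)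

effectiveLength : ∀ {k n} → Matrix k n → ℕ
effectiveLength G = count (NonzeroCoordinate G)

Divisible8 : ∀ {k n} → Matrix k n → Set
Divisible8 {k} G = ∀ (x : Fin k → Bool) → 8 ∣ weight (encode G x)

Exists8DivProjective : ℕ → Set
Exists8DivProjective m =
  Σ ℕ λ k → Σ ℕ λ n → Σ (Matrix k n) λ G →
    FullRank G × Projective G × effectiveLength G ≡ m × Divisible8 G

exceptionalLengths : List ℕ
exceptionalLengths = 15 ∷ 16 ∷ 30 ∷ 31 ∷ 32 ∷ 45 ∷ 46 ∷ 47 ∷ 48 ∷ 49 ∷ 50 ∷ 51 ∷ []

{-# OPTIONS --safe #-}
-- Nonexistence.  View the columns as a set K of n nonzero points of F₂ᵏ, fix a, and put s = 16 a + 8 − n.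
-- For a word c of weight 8 j the Fourier transform of f = 1_K + s δ₀ is 8 (2 a + 1 − 2 j), whose square is
-- 64 + 512 E(c) with E = (j − a)(j − a − 1)/2 ≥ 0.  Hence the Fourier transform of E is, up to the factor 2ᵏ/256,
-- half the autocorrelation of f (minus 64 δ₀): an integer-valued function e on F₂ᵏ, which is at most its value
-- h = (n + s² − 64)/2 at 0 and at least s on K.  Comparing with E(0) ≤ Σ E or with s ≤ h settles every length
-- except 33 and 59.  For n = 33 one sums e ≥ 7 over K.  For n = 59 and a = 3 one has h = 2, so
-- Σ (e − 1)(e − 2) ≥ 0 and Σ e (e − 1)(e − 2) ≤ 0.  By Parseval these sums are the second and third
-- convolution moments of E; two words with E = 3 have a sum with E ≥ 1, which bounds the third moment from
-- below, and together with 2ᵏ = 128 Σ E no weight distribution is left.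
-- Existence.  Direct sums of the codes of lengths 15, 16, 49, 50, 51 and 68, …, 74.
module Submission where

open import Defs
open import Data.Bool using (Bool; true; false; _∧_; _xor_)
import Data.Bool.Properties as Bool
open import Data.Empty using (⊥)
open import Data.Fin using (Fin; zero; suc)
import Data.Fin.Properties as Fin
open import Data.Integer using (ℤ; +_; _+_; _*_; _-_; -_; 0ℤ; 1ℤ; -1ℤ; -≤+; +≤+; +<+)
import Data.Integer as ℤ
import Data.Integer.DivMod as ℤ
import Data.Integer.Properties as ℤ
open import Data.Integer.Tactic.RingSolver using (solve-∀)
open import Data.List using (List; []; _∷_; _++_; length)
import Data.List as List
open import Data.List.Membership.DecPropositional using () renaming (_∈?_ to member?)
open import Data.List.Membership.Propositional using (_∈_)
import Data.List.Membership.Propositional.Properties as ∈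
import Data.List.Properties as List
open import Data.List.Relation.Unary.All using (All; []; _∷_)
import Data.List.Relation.Unary.All as All
import Data.List.Relation.Unary.All.Properties as All
import Data.List.Relation.Unary.AllPairs as AP
open import Data.List.Relation.Unary.Any using (here; there)
open import Data.List.Relation.Unary.Unique.Propositional using (Unique)
import Data.List.Relation.Unary.Unique.Propositional.Properties as Unique
open import Data.Nat using (ℕ; zero; suc; _≤_; z≤n; s≤s)
import Data.Nat as ℕ
open import Data.Nat.Divisibility using (_∣_; _∣?_; divides; quotient; ∣m∣n⇒∣m+n)
import Data.Nat.Properties as ℕ
import Data.Nat.Tactic.RingSolver as ℕ-Ring
open import Data.Product using (Σ; ∃; _×_; _,_; proj₁; proj₂)
open import Data.Sum using (_⊎_; inj₁; inj₂)
open import Data.Vec using (Vec; []; _∷_; replicate; zipWith; lookup; tabulate)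
import Data.Vec as Vec
import Data.Vec.Properties as Vec
open import Function using (_∘_)
open import Function.Bundles using (_⇔_; mk⇔)
open import Relation.Binary.PropositionalEquality
open import Relation.Nullary using (¬_; Dec; yes; no; contradiction)
open import Relation.Nullary.Decidable
  using (map′; _×-dec_; _⊎-dec_; _→-dec_; ¬?; True; toWitness; from-yes)

private variable
  X Y : Set
  k : ℕ

-- Codes as lists of columns, and the passage from and to generator matrices.

Word : ℕ → Set
Word = Vec Bool

𝟎 : ∀ {k} → Word k
𝟎 = replicate _ false

dot : ∀ {k} → Word k → Word k → Bool
dot []      []      = false
dot (a ∷ c) (b ∷ p) = (a ∧ b) xor dot c p

wt : ∀ {k} → Word k → List (Word k) → ℕ
wt c []       = 0
wt c (p ∷ ps) = b2n (dot c p) ℕ.+ wt c ps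

-- The columns of a generator matrix.  The code words are c ↦ (dot c p)_p, and their weights wt c.
record IsCode {k} (ps : List (Word k)) : Set where
  field
    unique    : Unique ps
    nonzero   : All (_≢ 𝟎) ps
    divisible : ∀ c → 8 ∣ wt c ps
    spanning  : ∀ c → wt c ps ≡ 0 → c ≡ 𝟎

Code : ℕ → Set
Code n = Σ ℕ λ k → Σ (List (Word k)) λ ps → IsCode ps × length ps ≡ n

dot-tabulate : ∀ {k} (x y : Fin k → Bool) → dot (tabulate x) (tabulate y) ≡ ⊕ (λ i → x i ∧ y i)
dot-tabulate {zero}  x y = refl
dot-tabulate {suc k} x y = cong ((x zero ∧ y zero) xor_) (dot-tabulate (x ∘ suc) (y ∘ suc))

⊕-cong : ∀ {k} {x y : Fin k → Bool} → (∀ i → x i ≡ y i) → ⊕ x ≡ ⊕ y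
⊕-cong {zero}  e = refl
⊕-cong {suc k} e = cong₂ _xor_ (e zero) (⊕-cong (e ∘ suc))

count-cong : ∀ {n} {f g : Fin n → Bool} → (∀ i → f i ≡ g i) → count f ≡ count g
count-cong {zero}  e = refl
count-cong {suc n} e = cong₂ ℕ._+_ (cong b2n (e zero)) (count-cong (e ∘ suc))

count-true : ∀ {n} {f : Fin n → Bool} → (∀ i → f i ≡ true) → count f ≡ n
count-true {zero}  e = refl
count-true {suc n} e = cong₂ ℕ._+_ (cong b2n (e zero)) (count-true (e ∘ suc))

count≡0 : ∀ {n} {f : Fin n → Bool} → (∀ i → f i ≡ false) → count f ≡ 0
count≡0 {zero}  e = refl
count≡0 {suc n} e = cong₂ ℕ._+_ (cong b2n (e zero)) (count≡0 (e ∘ suc))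

count≡0⁻¹ : ∀ {n} {f : Fin n → Bool} → count f ≡ 0 → ∀ i → f i ≡ false
count≡0⁻¹ {suc n} {f} e zero with f zero
... | false = refl
count≡0⁻¹ {suc n} {f} e (suc i) = count≡0⁻¹ (ℕ.m+n≡0⇒n≡0 (b2n (f zero)) e) i

wt-tabulate : ∀ {k n} (c : Word k) (p : Fin n → Word k) → wt c (List.tabulate p) ≡ count (λ j → dot c (p j))
wt-tabulate {n = zero}  c p = refl
wt-tabulate {n = suc n} c p = cong (b2n (dot c (p zero)) ℕ.+_) (wt-tabulate c (p ∘ suc))

any'-true : ∀ {k} {f : Fin k → Bool} → ¬ (∀ i → f i ≡ false) → any' f ≡ true
any'-true {zero}      ne = contradiction (λ ()) ne
any'-true {suc k} {f} ne with f zero in eq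
... | true  = refl
... | false = any'-true (λ e → ne λ { zero → eq ; (suc i) → e i })

lookup-injective : ∀ {A : Set} {xs : List A} → Unique xs → ∀ i j → List.lookup xs i ≡ List.lookup xs j → i ≡ j
lookup-injective (_ AP.∷ _)  zero    zero    e = refl
lookup-injective (x∉ AP.∷ _) zero    (suc j) e = contradiction e (All.lookup x∉ (∈.∈-lookup j))
lookup-injective (x∉ AP.∷ _) (suc i) zero    e = contradiction (sym e) (All.lookup x∉ (∈.∈-lookup i))
lookup-injective (_ AP.∷ u)  (suc i) (suc j) e = cong suc (lookup-injective u i j e)

tabulate-injective : ∀ {k} {f g : Fin k → Bool} → tabulate f ≡ tabulate g → ∀ i → f i ≡ g i
tabulate-injective {f = f} {g} e i =
  trans (sym (Vec.lookup∘tabulate f i)) (trans (cong (λ v → lookup v i) e) (Vec.lookup∘tabulate g i))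

tabulate-𝟎 : ∀ {k} {f : Fin k → Bool} → tabulate f ≡ 𝟎 → ∀ i → f i ≡ false
tabulate-𝟎 {f = f} e i =
  trans (sym (Vec.lookup∘tabulate f i)) (trans (cong (λ v → lookup v i) e) (Vec.lookup-replicate i false))

𝟎-lookup : ∀ {k} (v : Word k) → (∀ i → lookup v i ≡ false) → v ≡ 𝟎
𝟎-lookup []      e = refl
𝟎-lookup (b ∷ v) e = cong₂ _∷_ (e zero) (𝟎-lookup v (e ∘ suc))

-- No column is zero, so the effective length is the number of columns. Full rank says that only the
-- zero message is encoded as zero, which is `spanning`.
fromMatrix : ∀ {m} → Exists8DivProjective m → Code m
fromMatrix {m} (k , n , G , full , (nz , distinct) , eff , div) = k , List.tabulate p , code , len
  where
  p : Fin n → Word k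
  p j = tabulate (λ i → G i j)

  weight≡ : ∀ c → weight (encode G (lookup c)) ≡ wt c (List.tabulate p)
  weight≡ c = sym (trans (wt-tabulate c p) (count-cong λ j →
    trans (cong (λ d → dot d (p j)) (sym (Vec.tabulate∘lookup c))) (dot-tabulate (lookup c) (λ i → G i j))))

  p-injective : ∀ {i j} → p i ≡ p j → i ≡ j
  p-injective {i} {j} e with i Fin.≟ j
  ... | yes i≡j = i≡j
  ... | no  i≢j = contradiction (tabulate-injective e) (distinct i j i≢j)

  code : IsCode (List.tabulate p)
  code = record
    { unique    = Unique.tabulate⁺ p-injective
    ; nonzero   = All.tabulate⁺ (λ j e → nz j (tabulate-𝟎 e))
    ; divisible = λ c → subst (8 ∣_) (weight≡ c) (div (lookup c))
    ; spanning  = λ c e → 𝟎-lookup c (full (lookup c) (count≡0⁻¹ (trans (weight≡ c) e)))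
    }

  len : length (List.tabulate p) ≡ m
  len = trans (List.length-tabulate p) (trans (sym (count-true (λ j → any'-true (nz j)))) eff)

toMatrix : ∀ {m} → Code m → Exists8DivProjective m
toMatrix {m} (k , ps , code , len) = k , length ps , G , full , (nz , distinct) , eff , div
  where
  open IsCode code

  G : Matrix k (length ps)
  G i j = lookup (List.lookup ps j) i

  weight≡ : ∀ x → weight (encode G x) ≡ wt (tabulate x) ps
  weight≡ x = trans (sym (trans (wt-tabulate (tabulate x) (List.lookup ps)) (count-cong λ j →
    trans (cong (dot (tabulate x)) (sym (Vec.tabulate∘lookup (List.lookup ps j)))) (dot-tabulate x _))))
    (cong (wt (tabulate x)) (List.tabulate-lookup ps))

  nz : ∀ j → ¬ (∀ i → G i j ≡ false)
  nz j e = All.lookup nonzero (∈.∈-lookup j) (𝟎-lookup _ e)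

  distinct : ∀ j j' → j ≢ j' → ¬ (∀ i → G i j ≡ G i j')
  distinct j j' j≢j' e = j≢j' (lookup-injective unique j j'
    (trans (sym (Vec.tabulate∘lookup _)) (trans (Vec.tabulate-cong e) (Vec.tabulate∘lookup _))))

  full : FullRank G
  full x e = tabulate-𝟎 (spanning (tabulate x) (trans (sym (weight≡ x)) (count≡0 e)))

  eff : effectiveLength G ≡ m
  eff = trans (count-true (λ j → any'-true (nz j))) len

  div : Divisible8 G
  div x = subst (8 ∣_) (sym (weight≡ x)) (divisible (tabulate x))

dot-𝟎ʳ : ∀ {k} (c : Word k) → dot c 𝟎 ≡ false
dot-𝟎ʳ []      = refl
dot-𝟎ʳ (a ∷ c) = cong₂ _xor_ (Bool.∧-zeroʳ a) (dot-𝟎ʳ c)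

dot-𝟎ˡ : ∀ {k} (p : Word k) → dot 𝟎 p ≡ false
dot-𝟎ˡ []      = refl
dot-𝟎ˡ (_ ∷ p) = dot-𝟎ˡ p

wt-𝟎 : ∀ {k} (ps : List (Word k)) → wt 𝟎 ps ≡ 0
wt-𝟎 []       = refl
wt-𝟎 (p ∷ ps) = cong₂ ℕ._+_ (cong b2n (dot-𝟎ˡ p)) (wt-𝟎 ps)

-- Fourier analysis on F₂ᵏ

∑ : List X → (X → ℤ) → ℤ
∑ []       f = 0ℤ
∑ (x ∷ xs) f = f x + ∑ xs f

infixr 8 ∑
syntax ∑ xs (λ x → e) = ∑[ x ∈ xs ] e

∑-cong : ∀ (xs : List X) {f g : X → ℤ} → (∀ x → f x ≡ g x) → ∑ xs f ≡ ∑ xs g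
∑-cong []       e = refl
∑-cong (x ∷ xs) e = cong₂ _+_ (e x) (∑-cong xs e)

∑-mono : ∀ (xs : List X) {f g : X → ℤ} → (∀ x → f x ℤ.≤ g x) → ∑ xs f ℤ.≤ ∑ xs g
∑-mono []       e = ℤ.≤-refl
∑-mono (x ∷ xs) e = ℤ.+-mono-≤ (e x) (∑-mono xs e)

∑-mono-∈ : ∀ (xs : List X) {f g : X → ℤ} → (∀ {x} → x ∈ xs → f x ℤ.≤ g x) → ∑ xs f ℤ.≤ ∑ xs g
∑-mono-∈ []       e = ℤ.≤-refl
∑-mono-∈ (x ∷ xs) e = ℤ.+-mono-≤ (e (here refl)) (∑-mono-∈ xs (e ∘ there))

∑-0 : ∀ (xs : List X) → ∑ xs (λ _ → 0ℤ) ≡ 0ℤ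
∑-0 []       = refl
∑-0 (x ∷ xs) = trans (ℤ.+-identityˡ _) (∑-0 xs)

∑-nonneg : ∀ (xs : List X) {f : X → ℤ} → (∀ x → 0ℤ ℤ.≤ f x) → 0ℤ ℤ.≤ ∑ xs f
∑-nonneg xs {f} e = subst (ℤ._≤ ∑ xs f) (∑-0 xs) (∑-mono xs e)

∑-+ : ∀ (xs : List X) (f g : X → ℤ) → ∑[ x ∈ xs ] (f x + g x) ≡ ∑ xs f + ∑ xs g
∑-+ []       f g = refl
∑-+ (x ∷ xs) f g = trans (cong (_+_ (f x + g x)) (∑-+ xs f g)) (shuffle (f x) (g x) (∑ xs f) (∑ xs g))
  where
  shuffle : ∀ a b c d → (a + b) + (c + d) ≡ (a + c) + (b + d)
  shuffle = solve-∀

∑-*ˡ : ∀ (xs : List X) a (f : X → ℤ) → ∑[ x ∈ xs ] (a * f x) ≡ a * ∑ xs f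
∑-*ˡ []       a f = sym (ℤ.*-zeroʳ a)
∑-*ˡ (x ∷ xs) a f = trans (cong (_+_ (a * f x)) (∑-*ˡ xs a f)) (sym (ℤ.*-distribˡ-+ a (f x) (∑ xs f)))

∑-*ʳ : ∀ (xs : List X) a (f : X → ℤ) → ∑[ x ∈ xs ] (f x * a) ≡ ∑ xs f * a
∑-*ʳ xs a f = trans (∑-cong xs λ x → ℤ.*-comm (f x) a) (trans (∑-*ˡ xs a f) (ℤ.*-comm a _))

∑-const : ∀ (xs : List X) a → ∑ xs (λ _ → a) ≡ + length xs * a
∑-const []       a = refl
∑-const (x ∷ xs) a = trans (cong (_+_ a) (∑-const xs a)) (sym (ℤ.suc-* (+ length xs) a))

∑-swap : ∀ (xs : List X) (ys : List Y) (f : X → Y → ℤ) →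
  ∑[ x ∈ xs ] ∑[ y ∈ ys ] f x y ≡ ∑[ y ∈ ys ] ∑[ x ∈ xs ] f x y
∑-swap []       ys f = sym (∑-0 ys)
∑-swap (x ∷ xs) ys f = trans (cong (_+_ (∑ ys (f x))) (∑-swap xs ys f)) (sym (∑-+ ys _ _))

∑-* : ∀ (xs : List X) (ys : List Y) (f : X → ℤ) (g : Y → ℤ) →
  ∑[ x ∈ xs ] ∑[ y ∈ ys ] (f x * g y) ≡ ∑ xs f * ∑ ys g
∑-* xs ys f g = trans (∑-cong xs λ x → ∑-*ˡ ys (f x) g) (∑-*ʳ xs _ f)

∑-++ : ∀ (xs ys : List X) (f : X → ℤ) → ∑ (xs ++ ys) f ≡ ∑ xs f + ∑ ys f
∑-++ []       ys f = sym (ℤ.+-identityˡ _)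
∑-++ (x ∷ xs) ys f = trans (cong (_+_ (f x)) (∑-++ xs ys f)) (sym (ℤ.+-assoc (f x) _ _))

∑-map : ∀ (h : X → Y) (xs : List X) (f : Y → ℤ) → ∑ (List.map h xs) f ≡ ∑ xs (f ∘ h)
∑-map h []       f = refl
∑-map h (x ∷ xs) f = cong (_+_ (f (h x))) (∑-map h xs f)

-- Addition of words and sums over F₂ᵏ.

words : ∀ k → List (Word k)
words zero    = [] ∷ []
words (suc k) = List.map (false ∷_) (words k) ++ List.map (true ∷_) (words k)

∑-words : ∀ k (f : Word (suc k) → ℤ) →
  ∑ (words (suc k)) f ≡ ∑ (words k) (f ∘ (false ∷_)) + ∑ (words k) (f ∘ (true ∷_))
∑-words k f = trans (∑-++ (List.map (false ∷_) (words k)) _ f)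
  (cong₂ _+_ (∑-map (false ∷_) (words k) f) (∑-map (true ∷_) (words k) f))

infixl 6 _⊞_
_⊞_ : Word k → Word k → Word k
_⊞_ = zipWith _xor_

⊞-comm : ∀ (c d : Word k) → c ⊞ d ≡ d ⊞ c
⊞-comm []      []      = refl
⊞-comm (a ∷ c) (b ∷ d) = cong₂ _∷_ (Bool.xor-comm a b) (⊞-comm c d)

⊞-𝟎ʳ : ∀ (c : Word k) → c ⊞ 𝟎 ≡ c
⊞-𝟎ʳ []      = refl
⊞-𝟎ʳ (a ∷ c) = cong₂ _∷_ (Bool.xor-identityʳ a) (⊞-𝟎ʳ c)

⊞-self : ∀ (c : Word k) → c ⊞ c ≡ 𝟎
⊞-self []      = refl
⊞-self (a ∷ c) = cong₂ _∷_ (Bool.xor-same a) (⊞-self c)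

⊞-cancel : ∀ (c d : Word k) → c ⊞ (c ⊞ d) ≡ d
⊞-cancel []      []      = refl
⊞-cancel (a ∷ c) (b ∷ d) = cong₂ _∷_ (cancel a b) (⊞-cancel c d)
  where
  cancel : ∀ a b → a xor (a xor b) ≡ b
  cancel false b     = refl
  cancel true  false = refl
  cancel true  true  = refl

dot-⊞ˡ : ∀ (c d p : Word k) → dot (c ⊞ d) p ≡ dot c p xor dot d p
dot-⊞ˡ []      []      []      = refl
dot-⊞ˡ (a ∷ c) (b ∷ d) (true  ∷ p) rewrite Bool.∧-identityʳ (a xor b) | Bool.∧-identityʳ a | Bool.∧-identityʳ b =
  trans (cong ((a xor b) xor_) (dot-⊞ˡ c d p)) (interchange a b (dot c p) (dot d p))
  where
  interchange : ∀ w x y z → (w xor x) xor (y xor z) ≡ (w xor y) xor (x xor z)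
  interchange false false y     z = refl
  interchange false true  false z = refl
  interchange false true  true  z = refl
  interchange true  false y     z = Bool.not-distribˡ-xor y z
  interchange true  true  false z = sym (Bool.not-involutive z)
  interchange true  true  true  z = refl
dot-⊞ˡ (a ∷ c) (b ∷ d) (false ∷ p) rewrite Bool.∧-zeroʳ (a xor b) | Bool.∧-zeroʳ a | Bool.∧-zeroʳ b = dot-⊞ˡ c d p

-- Translation permutes the words: a leading `true` in `d` exchanges the two halves of the
-- enumeration.
∑-translate : ∀ (d : Word k) (f : Word k → ℤ) → ∑[ c ∈ words k ] f (d ⊞ c) ≡ ∑ (words k) f
∑-translate [] f = refl
∑-translate {suc k} (false ∷ d) f = trans (∑-words k (λ c → f ((false ∷ d) ⊞ c)))
  (trans (cong₂ _+_ (∑-translate d (f ∘ (false ∷_))) (∑-translate d (f ∘ (true ∷_)))) (sym (∑-words k f)))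
∑-translate {suc k} (true ∷ d) f = trans (∑-words k (λ c → f ((true ∷ d) ⊞ c)))
  (trans (cong₂ _+_ (∑-translate d (f ∘ (true ∷_))) (∑-translate d (f ∘ (false ∷_))))
  (trans (ℤ.+-comm (∑ (words k) (f ∘ (true ∷_))) _) (sym (∑-words k f))))

2^ : ℕ → ℤ
2^ k = + (2 ℕ.^ k)

∑-words-const : ∀ k a → ∑ (words k) (λ _ → a) ≡ 2^ k * a
∑-words-const zero    a = trans (ℤ.+-identityʳ a) (sym (ℤ.*-identityˡ a))
∑-words-const (suc k) a = trans (∑-words k (λ _ → a)) (trans (cong₂ _+_ (∑-words-const k a) (∑-words-const k a))
  (trans (double (2^ k) a) (cong (_* a) (sym (ℤ.pos-* 2 (2 ℕ.^ k))))))
  where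
  double : ∀ r a → r * a + r * a ≡ + 2 * r * a
  double = solve-∀

δ : Word k → ℤ
δ []          = 1ℤ
δ (false ∷ c) = δ c
δ (true  ∷ c) = 0ℤ

δ-𝟎 : ∀ k → δ (𝟎 {k}) ≡ 1ℤ
δ-𝟎 zero    = refl
δ-𝟎 (suc k) = δ-𝟎 k

δ-≢𝟎 : ∀ {c : Word k} → c ≢ 𝟎 → δ c ≡ 0ℤ
δ-≢𝟎 {c = []}        ne = contradiction refl ne
δ-≢𝟎 {c = false ∷ c} ne = δ-≢𝟎 (ne ∘ cong (false ∷_))
δ-≢𝟎 {c = true  ∷ c} ne = refl

δ-nonneg : ∀ (c : Word k) → 0ℤ ℤ.≤ δ c
δ-nonneg []          = +≤+ ℕ.z≤n
δ-nonneg (false ∷ c) = δ-nonneg c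
δ-nonneg (true  ∷ c) = ℤ.≤-refl

δ≤1 : ∀ (c : Word k) → δ c ℤ.≤ 1ℤ
δ≤1 []          = ℤ.≤-refl
δ≤1 (false ∷ c) = δ≤1 c
δ≤1 (true  ∷ c) = +≤+ ℕ.z≤n

∑-δ : ∀ (f : Word k → ℤ) → ∑[ c ∈ words k ] (f c * δ c) ≡ f 𝟎
∑-δ {zero}  f = trans (ℤ.+-identityʳ _) (ℤ.*-identityʳ _)
∑-δ {suc k} f = trans (∑-words k (λ c → f c * δ c)) (trans (cong₂ _+_ (∑-δ (f ∘ (false ∷_)))
  (trans (∑-cong (words k) λ c → ℤ.*-zeroʳ (f (true ∷ c))) (∑-0 (words k)))) (ℤ.+-identityʳ _))

-- Characters, Fourier transform and convolution.

χ : Bool → ℤ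
χ false = 1ℤ
χ true  = -1ℤ

χ-xor : ∀ a b → χ (a xor b) ≡ χ a * χ b
χ-xor false false = refl
χ-xor false true  = refl
χ-xor true  false = refl
χ-xor true  true  = refl

χ≤1 : ∀ a → χ a ℤ.≤ 1ℤ
χ≤1 false = ℤ.≤-refl
χ≤1 true  = -≤+

ψ : Word k → Word k → ℤ
ψ c p = χ (dot c p)

ψ-comm : ∀ (c p : Word k) → ψ c p ≡ ψ p c
ψ-comm c p = cong χ (dot-comm c p)
  where
  dot-comm : ∀ {k} (c p : Word k) → dot c p ≡ dot p c
  dot-comm []      []      = refl
  dot-comm (a ∷ c) (b ∷ p) = cong₂ _xor_ (Bool.∧-comm a b) (dot-comm c p)

ψ-⊞ˡ : ∀ (c d p : Word k) → ψ (c ⊞ d) p ≡ ψ c p * ψ d p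
ψ-⊞ˡ c d p = trans (cong χ (dot-⊞ˡ c d p)) (χ-xor (dot c p) (dot d p))

ψ-⊞ʳ : ∀ (c p q : Word k) → ψ c (p ⊞ q) ≡ ψ c p * ψ c q
ψ-⊞ʳ c p q = trans (ψ-comm c (p ⊞ q)) (trans (ψ-⊞ˡ p q c) (cong₂ _*_ (ψ-comm p c) (ψ-comm q c)))

ψ-𝟎ʳ : ∀ (c : Word k) → ψ c 𝟎 ≡ 1ℤ
ψ-𝟎ʳ c = cong χ (dot-𝟎ʳ c)

-- If `p` begins with `true`, the words beginning with `true` contribute the negative of what the
-- others contribute.
orthogonality : ∀ (p : Word k) → ∑[ c ∈ words k ] ψ c p ≡ 2^ k * δ p
orthogonality []          = refl
orthogonality {suc k} (false ∷ p) = trans (∑-words k (λ c → ψ c (false ∷ p)))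
  (trans (cong₂ _+_ (orthogonality p) (trans (∑-cong (words k) λ c → refl) (orthogonality p)))
  (trans (double (2^ k) (δ p)) (cong (_* δ p) (sym (ℤ.pos-* 2 (2 ℕ.^ k))))))
  where
  double : ∀ r a → r * a + r * a ≡ + 2 * r * a
  double = solve-∀
orthogonality {suc k} (true ∷ p) = trans (∑-words k (λ c → ψ c (true ∷ p)))
  (trans (cong (_+_ (∑ (words k) (λ c → ψ c p))) (trans (∑-cong (words k) λ c → χ-xor true (dot c p)) (∑-*ˡ (words k) -1ℤ _)))
  (trans (vanish (∑ (words k) (λ c → ψ c p))) (sym (ℤ.*-zeroʳ (2^ (suc k))))))
  where
  vanish : ∀ a → a + -1ℤ * a ≡ 0ℤ
  vanish = solve-∀

hat : (Word k → ℤ) → Word k → ℤ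
hat {k} f p = ∑[ c ∈ words k ] (f c * ψ c p)

infixl 7 _⋆_
-- Convolution on F₂ᵏ, where subtraction agrees with addition and `d ⊞ c` stands for c - d.
_⋆_ : (Word k → ℤ) → (Word k → ℤ) → Word k → ℤ
_⋆_ {k} f g c = ∑[ d ∈ words k ] (f d * g (d ⊞ c))

-- Since ψ c p = ψ d p · ψ (d ⊞ c) p, translating the inner sum by `d` separates the double sum into
-- a product.
hat-⋆ : ∀ (f g : Word k → ℤ) p → hat (f ⋆ g) p ≡ hat f p * hat g p
hat-⋆ {k} f g p = begin
  ∑[ c ∈ W ] ((f ⋆ g) c * ψ c p)
    ≡⟨ ∑-cong W (λ c → sym (∑-*ʳ W (ψ c p) _)) ⟩
  ∑[ c ∈ W ] ∑[ d ∈ W ] (f d * g (d ⊞ c) * ψ c p)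
    ≡⟨ ∑-swap W W _ ⟩
  ∑[ d ∈ W ] ∑[ c ∈ W ] (f d * g (d ⊞ c) * ψ c p)
    ≡⟨ ∑-cong W (λ d → ∑-cong W (λ c → step d c)) ⟩
  ∑[ d ∈ W ] ∑[ c ∈ W ] (f d * ψ d p * (g (d ⊞ c) * ψ (d ⊞ c) p))
    ≡⟨ ∑-cong W (λ d → ∑-*ˡ W (f d * ψ d p) _) ⟩
  ∑[ d ∈ W ] (f d * ψ d p * ∑[ c ∈ W ] (g (d ⊞ c) * ψ (d ⊞ c) p))
    ≡⟨ ∑-cong W (λ d → cong (f d * ψ d p *_) (∑-translate d (λ c → g c * ψ c p))) ⟩
  ∑[ d ∈ W ] (f d * ψ d p * hat g p)
    ≡⟨ ∑-*ʳ W (hat g p) _ ⟩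
  hat f p * hat g p ∎
  where
  open ≡-Reasoning
  W = words k
  shuffle : ∀ w x y z → w * x * y * z ≡ w * y * (x * z)
  shuffle = solve-∀
  step : ∀ d c → f d * g (d ⊞ c) * ψ c p ≡ f d * ψ d p * (g (d ⊞ c) * ψ (d ⊞ c) p)
  step d c = trans (cong (λ e → f d * g (d ⊞ c) * ψ e p) (sym (⊞-cancel d c)))
    (trans (cong (f d * g (d ⊞ c) *_) (ψ-⊞ˡ d (d ⊞ c) p))
    (trans (sym (ℤ.*-assoc (f d * g (d ⊞ c)) _ _)) (shuffle (f d) (g (d ⊞ c)) (ψ d p) (ψ (d ⊞ c) p))))

-- Fourier inversion at 𝟎: orthogonality annihilates every term except c = 𝟎.
∑-hat : ∀ (f : Word k → ℤ) → ∑ (words k) (hat f) ≡ 2^ k * f 𝟎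
∑-hat {k} f = begin
  ∑[ p ∈ W ] ∑[ c ∈ W ] (f c * ψ c p)     ≡⟨ ∑-swap W W _ ⟩
  ∑[ c ∈ W ] ∑[ p ∈ W ] (f c * ψ c p)     ≡⟨ ∑-cong W (λ c → ∑-*ˡ W (f c) _) ⟩
  ∑[ c ∈ W ] (f c * ∑[ p ∈ W ] ψ c p)     ≡⟨ ∑-cong W (λ c → cong (f c *_)
                                               (trans (∑-cong W (ψ-comm c)) (orthogonality c))) ⟩
  ∑[ c ∈ W ] (f c * (2^ k * δ c))         ≡⟨ ∑-cong W (λ c → shuffle (f c) (2^ k) (δ c)) ⟩
  ∑[ c ∈ W ] (2^ k * (f c * δ c))         ≡⟨ ∑-*ˡ W (2^ k) _ ⟩
  2^ k * ∑[ c ∈ W ] (f c * δ c)           ≡⟨ cong (2^ k *_) (∑-δ f) ⟩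
  2^ k * f 𝟎                              ∎
  where
  open ≡-Reasoning
  W = words k
  shuffle : ∀ x y z → x * (y * z) ≡ y * (x * z)
  shuffle = solve-∀

-- Parseval, as inversion at 𝟎 for `f ⋆ f`.
∑-hat² : ∀ (f : Word k → ℤ) → ∑[ p ∈ words k ] (hat f p * hat f p) ≡ 2^ k * ∑[ d ∈ words k ] (f d * f d)
∑-hat² {k} f = begin
  ∑[ p ∈ W ] (hat f p * hat f p)  ≡⟨ ∑-cong W (λ p → sym (hat-⋆ f f p)) ⟩
  ∑ W (hat (f ⋆ f))               ≡⟨ ∑-hat (f ⋆ f) ⟩
  2^ k * (f ⋆ f) 𝟎                ≡⟨ cong (2^ k *_) (∑-cong W λ d → cong (λ e → f d * f e) (⊞-𝟎ʳ d)) ⟩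
  2^ k * ∑[ d ∈ W ] (f d * f d)   ∎
  where
  open ≡-Reasoning
  W = words k

-- `P u v w` is summed over the triples with u ⊞ v ⊞ w = 𝟎, parametrised by u = d and w = c.
triples : (Word k → Word k → Word k → ℤ) → ℤ
triples {k} P = ∑[ c ∈ words k ] ∑[ d ∈ words k ] P d (d ⊞ c) c

∑-hat³ : ∀ (f : Word k → ℤ) →
  ∑[ p ∈ words k ] (hat f p * hat f p * hat f p) ≡ 2^ k * triples (λ u v w → f u * f v * f w)
∑-hat³ {k} f = begin
  ∑[ p ∈ W ] (hat f p * hat f p * hat f p)
    ≡⟨ ∑-cong W (λ p → trans (cong (_* hat f p) (sym (hat-⋆ f f p))) (sym (hat-⋆ (f ⋆ f) f p))) ⟩
  ∑ W (hat (f ⋆ f ⋆ f))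
    ≡⟨ ∑-hat (f ⋆ f ⋆ f) ⟩
  2^ k * (f ⋆ f ⋆ f) 𝟎
    ≡⟨ cong (2^ k *_) (∑-cong W λ c → trans (cong (λ e → (f ⋆ f) c * f e) (⊞-𝟎ʳ c)) (sym (∑-*ʳ W (f c) _))) ⟩
  2^ k * triples (λ u v w → f u * f v * f w) ∎
  where
  open ≡-Reasoning
  W = words k

-- Weights, sums of two columns, and the transform of the excess.

2^-positive : ∀ k → ℤ.Positive (2^ k)
2^-positive k = ℤ.positive (ℤ.+<+ (ℕ.m^n>0 2 k))

-- (j − a)(j − a − 1)/2
excess : ℕ → ℕ → ℕ
excess zero    zero    = 0
excess zero    (suc j) = j ℕ.+ excess zero j
excess (suc a) zero    = suc a ℕ.+ excess a zero
excess (suc a) (suc j) = excess a j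

-- Here t = 2 (a - j) + 1, so t² - 1 = 4 (j - a)(j - a - 1). The induction follows the recursion of
-- `excess`, which avoids subtraction and division in ℕ.
square-excess : ∀ a j → let t = + 2 * + a + 1ℤ - + 2 * + j in t * t ≡ 1ℤ + + 8 * + excess a j
square-excess zero zero = refl
square-excess zero (suc j) = trans (step (+ j)) (trans (cong (_+ + 8 * + j) (square-excess zero j))
  (collect (+ j) (+ excess zero j)))
  where
  step : ∀ j → let t = + 2 * 0ℤ + 1ℤ - + 2 * (1ℤ + j) ; u = + 2 * 0ℤ + 1ℤ - + 2 * j in t * t ≡ u * u + + 8 * j
  step = solve-∀
  collect : ∀ j e → 1ℤ + + 8 * e + + 8 * j ≡ 1ℤ + + 8 * (j + e)
  collect = solve-∀
square-excess (suc a) zero = trans (step (+ a)) (trans (cong (_+ + 8 * (1ℤ + + a)) (square-excess a zero))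
  (collect (+ a) (+ excess a zero)))
  where
  step : ∀ a → let t = + 2 * (1ℤ + a) + 1ℤ - + 2 * 0ℤ ; u = + 2 * a + 1ℤ - + 2 * 0ℤ in t * t ≡ u * u + + 8 * (1ℤ + a)
  step = solve-∀
  collect : ∀ a e → 1ℤ + + 8 * e + + 8 * (1ℤ + a) ≡ 1ℤ + + 8 * (1ℤ + a + e)
  collect = solve-∀
square-excess (suc a) (suc j) = trans (step (+ a) (+ j)) (square-excess a j)
  where
  step : ∀ a j → let t = + 2 * (1ℤ + a) + 1ℤ - + 2 * (1ℤ + j) ; u = + 2 * a + 1ℤ - + 2 * j in t * t ≡ u * u
  step = solve-∀

-- The Fourier transform of the indicator of the columns: a coordinate b of the code word
-- contributes 1 - 2 b.
∑-ψ : ∀ (c : Word k) ps → ∑[ p ∈ ps ] ψ c p ≡ + length ps - + 2 * + wt c ps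
∑-ψ c []       = refl
∑-ψ c (p ∷ ps) = trans (cong₂ _+_ (χ-b2n (dot c p)) (∑-ψ c ps)) (collect (+ b2n (dot c p)) (+ length ps) (+ wt c ps))
  where
  χ-b2n : ∀ a → χ a ≡ 1ℤ - + 2 * + b2n a
  χ-b2n false = refl
  χ-b2n true  = refl
  collect : ∀ b l w → (1ℤ - + 2 * b) + (l - + 2 * w) ≡ 1ℤ + l - + 2 * (b + w)
  collect = solve-∀

-- The indicator of `ps` when the entries are distinct. As a sum of translates of `δ` it is what
-- `orthogonality` produces.
multiplicity : List (Word k) → Word k → ℤ
multiplicity ps q = ∑[ p ∈ ps ] δ (p ⊞ q)

-- The number of unordered pairs of entries of `ps` with sum `q`. Unordered pairs give half of the
-- autocorrelation without a division.
pairs : List (Word k) → Word k → ℤ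
pairs []       q = 0ℤ
pairs (p ∷ ps) q = ∑[ r ∈ ps ] δ (p ⊞ r ⊞ q) + pairs ps q

𝟎-⊞ : ∀ (q : Word k) → 𝟎 ⊞ q ≡ q
𝟎-⊞ q = trans (⊞-comm 𝟎 q) (⊞-𝟎ʳ q)

⊞-≡𝟎 : ∀ {p q : Word k} → p ⊞ q ≡ 𝟎 → p ≡ q
⊞-≡𝟎 {p = p} {q} e = sym (trans (sym (⊞-cancel p q)) (trans (cong (p ⊞_) e) (⊞-𝟎ʳ p)))

-- The diagonal contributes `length ps` at q = 𝟎, and every unordered pair occurs in both orders.
∑∑-pairs : ∀ (ps : List (Word k)) q → ∑[ p ∈ ps ] ∑[ r ∈ ps ] δ (p ⊞ r ⊞ q) ≡ + length ps * δ q + + 2 * pairs ps q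
∑∑-pairs []       q = refl
∑∑-pairs (p ∷ ps) q = begin
  δ (p ⊞ p ⊞ q) + t + ∑[ r ∈ ps ] (δ (r ⊞ p ⊞ q) + ∑[ v ∈ ps ] δ (r ⊞ v ⊞ q))
    ≡⟨ cong₂ (λ a b → a + t + b) (cong δ (trans (cong (_⊞ q) (⊞-self p)) (𝟎-⊞ q))) (∑-+ ps _ _) ⟩
  δ q + t + (∑[ r ∈ ps ] δ (r ⊞ p ⊞ q) + ∑[ r ∈ ps ] ∑[ v ∈ ps ] δ (r ⊞ v ⊞ q))
    ≡⟨ cong₂ (λ a b → δ q + t + (a + b)) (∑-cong ps λ r → cong (λ v → δ (v ⊞ q)) (⊞-comm r p)) (∑∑-pairs ps q) ⟩
  δ q + t + (t + (+ length ps * δ q + + 2 * pairs ps q))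
    ≡⟨ collect (δ q) t (+ length ps) (pairs ps q) ⟩
  + length (p ∷ ps) * δ q + + 2 * (t + pairs ps q) ∎
  where
  open ≡-Reasoning
  t = ∑[ r ∈ ps ] δ (p ⊞ r ⊞ q)
  collect : ∀ d x l u → d + x + (x + (l * d + + 2 * u)) ≡ (1ℤ + l) * d + + 2 * (x + u)
  collect = solve-∀

pairs-nonneg : ∀ (ps : List (Word k)) q → 0ℤ ℤ.≤ pairs ps q
pairs-nonneg []       q = ℤ.≤-refl
pairs-nonneg (p ∷ ps) q = ℤ.+-mono-≤ (∑-nonneg ps λ r → δ-nonneg (p ⊞ r ⊞ q)) (pairs-nonneg ps q)

∑-vanish : ∀ {xs : List X} {f : X → ℤ} → All (λ x → f x ≡ 0ℤ) xs → ∑ xs f ≡ 0ℤ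
∑-vanish []       = refl
∑-vanish (e ∷ es) = cong₂ _+_ e (∑-vanish es)

pairs-𝟎 : ∀ {ps : List (Word k)} → Unique ps → pairs ps 𝟎 ≡ 0ℤ
pairs-𝟎 AP.[]          = refl
pairs-𝟎 {ps = p ∷ ps} (p∉ AP.∷ u) = cong₂ _+_
  (∑-vanish (All.map (λ p≢r → δ-≢𝟎 λ e → p≢r (⊞-≡𝟎 (trans (sym (⊞-𝟎ʳ _)) e))) p∉)) (pairs-𝟎 u)

multiplicity-𝟎 : ∀ {ps : List (Word k)} → All (_≢ 𝟎) ps → multiplicity ps 𝟎 ≡ 0ℤ
multiplicity-𝟎 nz = ∑-vanish (All.map (λ p≢𝟎 → δ-≢𝟎 (p≢𝟎 ∘ trans (sym (⊞-𝟎ʳ _)))) nz)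

multiplicity-nonneg : ∀ (ps : List (Word k)) q → 0ℤ ℤ.≤ multiplicity ps q
multiplicity-nonneg ps q = ∑-nonneg ps λ p → δ-nonneg (p ⊞ q)

1≤multiplicity : ∀ {ps : List (Word k)} {q} → q ∈ ps → 1ℤ ℤ.≤ multiplicity ps q
1≤multiplicity {k} {p ∷ ps} {q} (here refl) =
  ℤ.+-mono-≤ (ℤ.≤-reflexive (sym (trans (cong δ (⊞-self q)) (δ-𝟎 k)))) (multiplicity-nonneg ps q)
1≤multiplicity {k} {p ∷ ps} {q} (there q∈) = ℤ.+-mono-≤ (δ-nonneg (p ⊞ q)) (1≤multiplicity q∈)

shift : ℕ → ℕ → ℤ
shift a n = + 16 * + a + + 8 - + n

-- n + s² is the autocorrelation of 1_K + s δ at 𝟎; the 64 removed is the constant term of `G²`.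
defect : ℕ → ℕ → ℤ
defect a n = + n + shift a n * shift a n - + 64

-- `h` is tied to `defect` by an equation and not defined as a quotient, so that particular lengths
-- can supply a numeral.
module Spectrum {ps : List (Word k)} (code : IsCode ps) (a : ℕ) (h : ℤ)
  (2h : + 2 * h ≡ defect a (length ps)) where

  open IsCode code
  W = words k
  n = + length ps
  s = shift a (length ps)

  j : Word k → ℕ
  j c = quotient (divisible c)

  wt≡ : ∀ c → wt c ps ≡ j c ℕ.* 8
  wt≡ c = _∣_.equality (divisible c)

  E : Word k → ℤ
  E c = + excess a (j c)

  G : Word k → ℤ
  G c = ∑ ps (ψ c) + s

  G≡ : ∀ c → G c ≡ + 8 * (+ 2 * + a + 1ℤ - + 2 * + j c)
  G≡ c = trans (cong (_+ s) (trans (∑-ψ c ps) (cong (λ w → n - + 2 * w) (trans (cong +_ (wt≡ c)) (ℤ.pos-* (j c) 8)))))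
    (collect n (+ a) (+ j c))
    where
    collect : ∀ n a j → n - + 2 * (j * + 8) + (+ 16 * a + + 8 - n) ≡ + 8 * (+ 2 * a + 1ℤ - + 2 * j)
    collect = solve-∀

  G² : ∀ c → G c * G c ≡ + 64 + + 512 * E c
  G² c = trans (cong₂ _*_ (G≡ c) (G≡ c)) (trans (square (+ 2 * + a + 1ℤ - + 2 * + j c))
    (trans (cong (+ 64 *_) (square-excess a (j c))) (collect (E c))))
    where
    square : ∀ t → + 8 * t * (+ 8 * t) ≡ + 64 * (t * t)
    square = solve-∀
    collect : ∀ e → + 64 * (1ℤ + + 8 * e) ≡ + 64 + + 512 * e
    collect = solve-∀

  -- half the autocorrelation of 1_ps + s δ, less 32 δ
  e : Word k → ℤ
  e q = h * δ q + pairs ps q + s * multiplicity ps q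

  e-𝟎 : e 𝟎 ≡ h
  e-𝟎 = trans (cong₂ _+_ (cong₂ _+_ (cong (h *_) (δ-𝟎 k)) (pairs-𝟎 unique)) (cong (s *_) (multiplicity-𝟎 nonzero)))
    (collect h s)
    where
    collect : ∀ h s → h * 1ℤ + 0ℤ + s * 0ℤ ≡ h
    collect = solve-∀

  private
    -- The transform of G², that is 2ᵏ times the autocorrelation of 1_ps + s δ. It is evaluated once
    -- through the excess of the weights and once through the columns.
    energy : Word k → ℤ
    energy q = ∑[ c ∈ W ] (G c * G c * ψ c q)

    energy-hat : ∀ q → energy q ≡ + 64 * (2^ k * δ q) + + 512 * hat E q
    energy-hat q = trans (∑-cong W λ c → trans (cong (_* ψ c q) (G² c)) (expand (E c) (ψ c q)))
      (trans (∑-+ W _ _) (cong₂ _+_ (trans (∑-*ˡ W (+ 64) _) (cong (+ 64 *_) (orthogonality q))) (∑-*ˡ W (+ 512) _)))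
      where
      expand : ∀ e x → (+ 64 + + 512 * e) * x ≡ + 64 * x + + 512 * (e * x)
      expand = solve-∀

    -- After multiplying out, the summand is ψ c (p ⊞ r ⊞ q), whose sum over `c` is 2ᵏ if p ⊞ r = q
    -- and 0 otherwise.
    quadratic : ∀ q → ∑[ c ∈ W ] (∑ ps (ψ c) * ∑ ps (ψ c) * ψ c q) ≡ 2^ k * (n * δ q + + 2 * pairs ps q)
    quadratic q = begin
      ∑[ c ∈ W ] (∑ ps (ψ c) * ∑ ps (ψ c) * ψ c q)
        ≡⟨ ∑-cong W (λ c → trans (cong (_* ψ c q) (sym (∑-* ps ps (ψ c) (ψ c))))
             (trans (sym (∑-*ʳ ps (ψ c q) _)) (∑-cong ps λ p → sym (∑-*ʳ ps (ψ c q) _)))) ⟩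
      ∑[ c ∈ W ] ∑[ p ∈ ps ] ∑[ r ∈ ps ] (ψ c p * ψ c r * ψ c q)
        ≡⟨ ∑-cong W (λ c → ∑-cong ps λ p → ∑-cong ps λ r →
             sym (trans (ψ-⊞ʳ c (p ⊞ r) q) (cong (_* ψ c q) (ψ-⊞ʳ c p r)))) ⟩
      ∑[ c ∈ W ] ∑[ p ∈ ps ] ∑[ r ∈ ps ] ψ c (p ⊞ r ⊞ q)
        ≡⟨ ∑-swap W ps _ ⟩
      ∑[ p ∈ ps ] ∑[ c ∈ W ] ∑[ r ∈ ps ] ψ c (p ⊞ r ⊞ q)
        ≡⟨ ∑-cong ps (λ p → trans (∑-swap W ps _) (trans (∑-cong ps λ r → orthogonality (p ⊞ r ⊞ q)) (∑-*ˡ ps (2^ k) _))) ⟩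
      ∑[ p ∈ ps ] (2^ k * ∑[ r ∈ ps ] δ (p ⊞ r ⊞ q))
        ≡⟨ trans (∑-*ˡ ps (2^ k) _) (cong (2^ k *_) (∑∑-pairs ps q)) ⟩
      2^ k * (n * δ q + + 2 * pairs ps q) ∎
      where open ≡-Reasoning

    linear : ∀ q → ∑[ c ∈ W ] (∑ ps (ψ c) * ψ c q) ≡ 2^ k * multiplicity ps q
    linear q = trans (∑-cong W λ c → trans (sym (∑-*ʳ ps (ψ c q) _)) (∑-cong ps λ p → sym (ψ-⊞ʳ c p q)))
      (trans (∑-swap W ps _) (trans (∑-cong ps λ p → orthogonality (p ⊞ q)) (∑-*ˡ ps (2^ k) _)))

    energy-pairs : ∀ q → energy q ≡ 2^ k * (n * δ q + + 2 * pairs ps q) +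
      (+ 2 * s * (2^ k * multiplicity ps q) + s * s * (2^ k * δ q))
    energy-pairs q = trans (∑-cong W λ c → expand (∑ ps (ψ c)) s (ψ c q))
      (trans (∑-+ W _ _) (cong₂ _+_ (quadratic q) (trans (∑-+ W _ _) (cong₂ _+_
        (trans (∑-*ˡ W (+ 2 * s) _) (cong (+ 2 * s *_) (linear q)))
        (trans (∑-*ˡ W (s * s) _) (cong (s * s *_) (orthogonality q)))))))
      where
      expand : ∀ g s x → (g + s) * (g + s) * x ≡ g * g * x + (+ 2 * s * (g * x) + s * s * x)
      expand = solve-∀

  -- Subtracting 64 · 2ᵏ · δ q from both evaluations of `energy` leaves 512 times the transform of
  -- `E` on one side and 2ᵏ · 2 e on the other; the factor 2 is then cancelled.
  spectrum : ∀ q → + 256 * hat E q ≡ 2^ k * e q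
  spectrum q = ℤ.*-cancelˡ-≡ (+ 2) _ _ (begin
    + 2 * (+ 256 * hat E q)
      ≡⟨ isolate (hat E q) (2^ k * δ q) ⟩
    + 64 * (2^ k * δ q) + + 512 * hat E q - + 64 * (2^ k * δ q)
      ≡⟨ cong (_- + 64 * (2^ k * δ q)) (trans (sym (energy-hat q)) (energy-pairs q)) ⟩
    2^ k * (n * δ q + + 2 * u) + (+ 2 * s * (2^ k * m) + s * s * (2^ k * δ q)) - + 64 * (2^ k * δ q)
      ≡⟨ collect (2^ k) n (δ q) u s m ⟩
    2^ k * ((n + s * s - + 64) * δ q + + 2 * u + + 2 * s * m)
      ≡⟨ cong (λ t → 2^ k * (t * δ q + + 2 * u + + 2 * s * m)) (sym 2h) ⟩
    2^ k * (+ 2 * h * δ q + + 2 * u + + 2 * s * m)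
      ≡⟨ halve (2^ k) h (δ q) u s m ⟩
    + 2 * (2^ k * e q) ∎)
    where
    open ≡-Reasoning
    u = pairs ps q
    m = multiplicity ps q
    isolate : ∀ f r → + 2 * (+ 256 * f) ≡ + 64 * r + + 512 * f - + 64 * r
    isolate = solve-∀
    collect : ∀ r n d u s m → r * (n * d + + 2 * u) + (+ 2 * s * (r * m) + s * s * (r * d)) - + 64 * (r * d)
      ≡ r * ((n + s * s - + 64) * d + + 2 * u + + 2 * s * m)
    collect = solve-∀
    halve : ∀ r h d u s m → r * (+ 2 * h * d + + 2 * u + + 2 * s * m) ≡ + 2 * (r * (h * d + u + s * m))
    halve = solve-∀

  hat-𝟎 : hat E 𝟎 ≡ ∑ W E
  hat-𝟎 = ∑-cong W λ c → trans (cong (E c *_) (ψ-𝟎ʳ c)) (ℤ.*-identityʳ (E c))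

  total : + 256 * ∑ W E ≡ 2^ k * h
  total = trans (cong (+ 256 *_) (sym hat-𝟎)) (trans (spectrum 𝟎) (cong (2^ k *_) e-𝟎))

  hat≤ : ∀ q → hat E q ℤ.≤ ∑ W E
  hat≤ q = ∑-mono W λ c → ℤ.≤-trans (ℤ.*-monoˡ-≤-nonNeg (E c) (χ≤1 (dot c q))) (ℤ.≤-reflexive (ℤ.*-identityʳ (E c)))

  -- `E` is nonnegative and characters are at most 1, so the transform of `E` is greatest at 𝟎,
  -- where `e` has the value `h`.
  e≤h : ∀ q → e q ℤ.≤ h
  e≤h q = ℤ.*-cancelˡ-≤-pos (e q) h (2^ k) {{2^-positive k}} (begin
    2^ k * e q         ≡⟨ sym (spectrum q) ⟩
    + 256 * hat E q    ≤⟨ ℤ.*-monoˡ-≤-nonNeg (+ 256) (hat≤ q) ⟩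
    + 256 * ∑ W E      ≡⟨ total ⟩
    2^ k * h           ∎)
    where open ℤ.≤-Reasoning

  j-𝟎 : j 𝟎 ≡ 0
  j-𝟎 = ℕ.m*n≡0⇒m≡0 (j 𝟎) 8 (trans (sym (wt≡ 𝟎)) (wt-𝟎 ps))

  j≡0⇒𝟎 : ∀ c → j c ≡ 0 → c ≡ 𝟎
  j≡0⇒𝟎 c e = spanning c (trans (wt≡ c) (cong (ℕ._* 8) e))

  E-𝟎≤∑ : + excess a 0 ℤ.≤ ∑ W E
  E-𝟎≤∑ = begin
    + excess a 0               ≡⟨ cong (λ i → + excess a i) (sym j-𝟎) ⟩
    E 𝟎                        ≡⟨ sym (∑-δ E) ⟩
    ∑[ c ∈ W ] (E c * δ c)     ≤⟨ ∑-mono W (λ c → Eδ≤E c) ⟩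
    ∑ W E                      ∎
    where
    open ℤ.≤-Reasoning
    Eδ≤E : ∀ c → E c * δ c ℤ.≤ E c
    Eδ≤E c = ℤ.≤-trans (ℤ.*-monoˡ-≤-nonNeg (E c) (δ≤1 c)) (ℤ.≤-reflexive (ℤ.*-identityʳ (E c)))

-- Two criteria that exclude a length.

module Criterion {ps : List (Word k)} (code : IsCode ps) (a : ℕ) (h : ℤ)
  (2h : + 2 * h ≡ defect a (length ps)) where

  open Spectrum code a h 2h

  -- By `total` a negative `h` contradicts E ≥ 0, and h = 0 contradicts E 𝟎 > 0. The chain treats
  -- both cases at once, since 2ᵏ h ≤ h for h ≤ 0.
  quadratic-criterion : h ℤ.≤ 0ℤ → ¬ (h ℤ.< + excess a 0)
  quadratic-criterion h≤0 h<E = ℤ.<-irrefl refl (begin-strict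
    h                      <⟨ h<E ⟩
    + excess a 0           ≡⟨ sym (ℤ.*-identityˡ _) ⟩
    1ℤ * + excess a 0      ≤⟨ ℤ.*-monoʳ-≤-nonNeg (+ excess a 0) {1ℤ} {+ 256} (+≤+ (s≤s z≤n)) ⟩
    + 256 * + excess a 0   ≤⟨ ℤ.*-monoˡ-≤-nonNeg (+ 256) E-𝟎≤∑ ⟩
    + 256 * ∑ W E          ≡⟨ total ⟩
    2^ k * h               ≤⟨ ℤ.*-monoʳ-≤-nonPos h {{ℤ.nonPositive h≤0}} (+≤+ (ℕ.m^n>0 2 k)) ⟩
    1ℤ * h                 ≡⟨ ℤ.*-identityˡ h ⟩
    h                      ∎)
    where open ℤ.≤-Reasoning

  -- At a column `δ` vanishes, `pairs` is nonnegative and `multiplicity` is at least 1, so already s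
  -- ≤ e p.
  point-criterion : 0ℤ ℤ.≤ s → ∀ {p} → p ∈ ps → s ℤ.≤ h
  point-criterion 0≤s {p} p∈ = begin
    s                       ≡⟨ expand s h ⟩
    h * 0ℤ + 0ℤ + s * 1ℤ    ≤⟨ ℤ.+-mono-≤ (ℤ.+-mono-≤ (ℤ.≤-reflexive (cong (h *_) (sym (δ-≢𝟎 (All.lookup nonzero p∈)))))
                                  (pairs-nonneg ps p)) (ℤ.*-monoˡ-≤-nonNeg s {{ℤ.nonNegative 0≤s}} (1≤multiplicity p∈)) ⟩
    e p                     ≤⟨ e≤h p ⟩
    h                       ∎
    where
    open ℤ.≤-Reasoning
    open IsCode code
    expand : ∀ s h → s ≡ h * 0ℤ + 0ℤ + s * 1ℤ
    expand = solve-∀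

-- Length 33

module Length33 {ps : List (Word k)} (code : IsCode ps) (len : length ps ≡ 33) where

  -- a = 2 gives s = 7 and 2 h = 33 + 49 - 64 = 18. Neither criterion applies, as 0 < h and s ≤ h.
  open Spectrum code 2 (+ 9) (cong (defect 2) (sym len))

  7≤e : ∀ {p} → p ∈ ps → + 7 ℤ.≤ e p
  7≤e {p} p∈ = begin
    0ℤ + 0ℤ + + 7 * 1ℤ
      ≤⟨ ℤ.+-mono-≤ (ℤ.+-mono-≤ (ℤ.*-monoˡ-≤-nonNeg (+ 9) (δ-nonneg p)) (pairs-nonneg ps p))
           (ℤ.*-monoˡ-≤-nonNeg (+ 7) (1≤multiplicity p∈)) ⟩
    + 9 * δ p + pairs ps p + + 7 * multiplicity ps p
      ≡⟨ cong (λ l → + 9 * δ p + pairs ps p + (+ 40 - + l) * multiplicity ps p) (sym len) ⟩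
    e p ∎
    where open ℤ.≤-Reasoning

  -- A nonzero word has weight at least 8, and 33 - 16 = 17. For 𝟎 both sides are 99: E 𝟎 = 3 and 48
  -- = 3 · (33 - 17).
  E-weight : ∀ c → E c * (+ 33 - + 2 * + wt c ps) ℤ.≤ + 17 * E c + + 48 * δ c
  E-weight c with j c in eq | wt≡ c
  ... | zero  | w rewrite w | j≡0⇒𝟎 c eq | δ-𝟎 k = ℤ.≤-refl
  ... | suc i | w rewrite w = begin
    + x * (+ 33 - + 2 * + (suc i ℕ.* 8))  ≤⟨ ℤ.*-monoˡ-≤-nonNeg (+ x) 17≥ ⟩
    + x * + 17                            ≡⟨ ℤ.*-comm (+ x) (+ 17) ⟩
    + 17 * + x                            ≡⟨ sym (ℤ.+-identityʳ _) ⟩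
    + 17 * + x + 0ℤ                       ≤⟨ ℤ.+-monoʳ-≤ (+ 17 * + x) (ℤ.*-monoˡ-≤-nonNeg (+ 48) (δ-nonneg c)) ⟩
    + 17 * + x + + 48 * δ c               ∎
    where
    open ℤ.≤-Reasoning
    x = excess 2 (suc i)
    17≥ : + 33 - + 2 * + (suc i ℕ.* 8) ℤ.≤ + 17
    17≥ = ℤ.+-monoʳ-≤ (+ 33) (ℤ.neg-mono-≤ (ℤ.*-monoˡ-≤-nonNeg (+ 2) (+≤+ (ℕ.m≤m+n 8 (i ℕ.* 8)))))

  ∑-hat-points : ∑ ps (hat E) ≡ ∑[ c ∈ W ] (E c * (+ 33 - + 2 * + wt c ps))
  ∑-hat-points = trans (∑-swap ps W _) (∑-cong W λ c → trans (∑-*ˡ ps (E c) (ψ c))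
    (cong (E c *_) (trans (∑-ψ c ps) (cong (λ l → + l - + 2 * + wt c ps) len))))

  -- The sum of 2ᵏ e over the 33 columns is at least 2ᵏ · 33 · 7. Rewritten as a sum over words it
  -- is bounded by `E-weight` and `total`, with 12288 = 256 · 48 and 153 = 17 · 9.
  2^k*231≤ : 2^ k * + 231 ℤ.≤ + 12288 + 2^ k * + 153
  2^k*231≤ = begin
    2^ k * (+ 33 * + 7)                        ≡⟨ cong (λ l → 2^ k * (+ l * + 7)) (sym len) ⟩
    2^ k * (+ length ps * + 7)                 ≡⟨ cong (2^ k *_) (sym (∑-const ps (+ 7))) ⟩
    2^ k * ∑ ps (λ _ → + 7)                    ≤⟨ ℤ.*-monoˡ-≤-nonNeg (2^ k) (∑-mono-∈ ps 7≤e) ⟩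
    2^ k * ∑ ps e                              ≡⟨ sym (∑-*ˡ ps (2^ k) e) ⟩
    ∑[ p ∈ ps ] (2^ k * e p)                   ≡⟨ ∑-cong ps (λ p → sym (spectrum p)) ⟩
    ∑[ p ∈ ps ] (+ 256 * hat E p)              ≡⟨ ∑-*ˡ ps (+ 256) (hat E) ⟩
    + 256 * ∑ ps (hat E)                       ≡⟨ cong (+ 256 *_) ∑-hat-points ⟩
    + 256 * ∑[ c ∈ W ] (E c * (+ 33 - + 2 * + wt c ps))
                                               ≤⟨ ℤ.*-monoˡ-≤-nonNeg (+ 256) (∑-mono W E-weight) ⟩
    + 256 * ∑[ c ∈ W ] (+ 17 * E c + + 48 * δ c)
                                               ≡⟨ cong (+ 256 *_) (trans (∑-+ W _ _) (cong₂ _+_ (∑-*ˡ W (+ 17) E) (∑-δ {k} (λ _ → + 48)))) ⟩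
    + 256 * (+ 17 * ∑ W E + + 48)              ≡⟨ expand (∑ W E) ⟩
    + 12288 + + 17 * (+ 256 * ∑ W E)           ≡⟨ cong (λ t → + 12288 + + 17 * t) total ⟩
    + 12288 + + 17 * (2^ k * + 9)              ≡⟨ collect (2^ k) ⟩
    + 12288 + 2^ k * + 153                     ∎
    where
    open ℤ.≤-Reasoning
    expand : ∀ y → + 256 * (+ 17 * y + + 48) ≡ + 12288 + + 17 * (+ 256 * y)
    expand = solve-∀
    collect : ∀ r → + 12288 + + 17 * (r * + 9) ≡ + 12288 + r * + 153
    collect = solve-∀

  2^k*78≤ : 2^ k * + 78 ℤ.≤ + 12288
  2^k*78≤ = subst₂ ℤ._≤_ (difference (2^ k)) (cancel (2^ k)) (ℤ.+-monoˡ-≤ (- (2^ k * + 153)) 2^k*231≤)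
    where
    difference : ∀ r → r * + 231 + - (r * + 153) ≡ r * + 78
    difference = solve-∀
    cancel : ∀ r → + 12288 + r * + 153 + - (r * + 153) ≡ + 12288
    cancel = solve-∀

  k<8 : k ℕ.< 8
  k<8 = ℕ.≰⇒> λ 8≤k → ℕ.<⇒≱ {12288} {2 ℕ.^ 8 ℕ.* 78} (from-yes (12288 ℕ.<? 2 ℕ.^ 8 ℕ.* 78))
    (ℕ.≤-trans (ℕ.*-monoˡ-≤ 78 (ℕ.^-monoʳ-≤ 2 8≤k))
      (ℤ.drop‿+≤+ (subst (ℤ._≤ + 12288) (sym (ℤ.pos-* (2 ℕ.^ k) 78)) 2^k*78≤)))

  256∣ : 256 ∣ 2 ℕ.^ k ℕ.* 9
  256∣ = divides ℤ.∣ ∑ W E ∣ (begin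
    2 ℕ.^ k ℕ.* 9                ≡⟨ sym (ℤ.abs-* (2^ k) (+ 9)) ⟩
    ℤ.∣ 2^ k * + 9 ∣             ≡⟨ cong ℤ.∣_∣ (sym total) ⟩
    ℤ.∣ + 256 * ∑ W E ∣          ≡⟨ ℤ.abs-* (+ 256) (∑ W E) ⟩
    256 ℕ.* ℤ.∣ ∑ W E ∣          ≡⟨ ℕ.*-comm 256 ℤ.∣ ∑ W E ∣ ⟩
    ℤ.∣ ∑ W E ∣ ℕ.* 256          ∎)
    where open ≡-Reasoning

  absurd : ⊥
  -- As 9 is odd, 256 divides 9 · 2ⁱ only for i ≥ 8.
  absurd = from-yes (ℕ.allUpTo? (λ i → ¬? (256 ∣? 2 ℕ.^ i ℕ.* 9)) 8) k<8 256∣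

-- Length 59

wt-⊞ : ∀ (c d : Word k) ps → wt (c ⊞ d) ps ℕ.≤ wt c ps ℕ.+ wt d ps
wt-⊞ c d []       = z≤n
wt-⊞ c d (p ∷ ps) rewrite dot-⊞ˡ c d p = ℕ.≤-trans (ℕ.+-mono-≤ (b2n-xor (dot c p) (dot d p)) (wt-⊞ c d ps))
  (ℕ.≤-reflexive (interchange (b2n (dot c p)) (b2n (dot d p)) (wt c ps) (wt d ps)))
  where
  b2n-xor : ∀ a b → b2n (a xor b) ℕ.≤ b2n a ℕ.+ b2n b
  b2n-xor false b     = ℕ.≤-refl
  b2n-xor true  false = ℕ.≤-refl
  b2n-xor true  true  = z≤n
  interchange : ∀ w x y z → (w ℕ.+ x) ℕ.+ (y ℕ.+ z) ≡ (w ℕ.+ y) ℕ.+ (x ℕ.+ z)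
  interchange = ℕ-Ring.solve-∀

-- At each coordinate none or exactly two of `c`, `d` and `c ⊞ d` are 1.
wt-perimeter : ∀ (c d : Word k) ps → wt c ps ℕ.+ wt d ps ℕ.+ wt (c ⊞ d) ps ℕ.≤ 2 ℕ.* length ps
wt-perimeter c d []       = z≤n
wt-perimeter c d (p ∷ ps) rewrite dot-⊞ˡ c d p = begin
  (x ℕ.+ wt c ps) ℕ.+ (y ℕ.+ wt d ps) ℕ.+ (z ℕ.+ wt (c ⊞ d) ps)
    ≡⟨ interchange x (wt c ps) y (wt d ps) z (wt (c ⊞ d) ps) ⟩
  (x ℕ.+ y ℕ.+ z) ℕ.+ (wt c ps ℕ.+ wt d ps ℕ.+ wt (c ⊞ d) ps)
    ≤⟨ ℕ.+-mono-≤ (b2n-perimeter (dot c p) (dot d p)) (wt-perimeter c d ps) ⟩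
  2 ℕ.+ 2 ℕ.* length ps
    ≡⟨ sym (ℕ.*-suc 2 (length ps)) ⟩
  2 ℕ.* suc (length ps) ∎
  where
  open ℕ.≤-Reasoning
  x = b2n (dot c p)
  y = b2n (dot d p)
  z = b2n (dot c p xor dot d p)
  b2n-perimeter : ∀ a b → b2n a ℕ.+ b2n b ℕ.+ b2n (a xor b) ℕ.≤ 2
  b2n-perimeter false false = z≤n
  b2n-perimeter false true  = ℕ.≤-refl
  b2n-perimeter true  false = ℕ.≤-refl
  b2n-perimeter true  true  = ℕ.≤-refl
  interchange : ∀ a b c d e f → (a ℕ.+ b) ℕ.+ (c ℕ.+ d) ℕ.+ (e ℕ.+ f) ≡ (a ℕ.+ c ℕ.+ e) ℕ.+ (b ℕ.+ d ℕ.+ f)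
  interchange = ℕ-Ring.solve-∀

⊞-cancelʳ : ∀ (c d : Word k) → (c ⊞ d) ⊞ d ≡ c
⊞-cancelʳ c d = trans (⊞-comm (c ⊞ d) d) (trans (cong (d ⊞_) (⊞-comm c d)) (⊞-cancel d c))

-- Any two members of a triple with sum 𝟎 run freely through all pairs of words and determine the
-- third.
triples-uv : ∀ (θ : Word k → Word k → ℤ) → triples (λ u v w → θ u v) ≡ ∑[ u ∈ words k ] ∑[ v ∈ words k ] θ u v
triples-uv {k} θ = trans (∑-swap (words k) (words k) _) (∑-cong (words k) λ u → ∑-translate u (θ u))

triples-vw : ∀ (θ : Word k → Word k → ℤ) → triples (λ u v w → θ v w) ≡ ∑[ u ∈ words k ] ∑[ v ∈ words k ] θ u v
triples-vw {k} θ = trans (∑-cong (words k) λ c → trans (∑-cong (words k) λ d → cong (λ v → θ v c) (⊞-comm d c))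
  (∑-translate c (λ v → θ v c))) (∑-swap (words k) (words k) _)

triples-cyclic : ∀ (θ : Word k → Word k → ℤ) →
  triples (λ u v w → θ u v + θ v w + θ w u) ≡ + 3 * ∑[ u ∈ words k ] ∑[ v ∈ words k ] θ u v
triples-cyclic {k} θ = trans
  (trans (trans (∑-cong (words k) λ c → trans (∑-+ (words k) _ _) (cong (_+ ∑ (words k) (θ c)) (∑-+ (words k) _ _)))
    (trans (∑-+ (words k) _ _) (cong (_+ Θ) (∑-+ (words k) _ _))))
    (cong₂ (λ a b → a + b + Θ) (triples-uv θ) (triples-vw θ)))
  (collect Θ)
  where
  Θ = ∑[ u ∈ words k ] ∑[ v ∈ words k ] θ u v
  collect : ∀ t → t + t + t ≡ + 3 * t
  collect = solve-∀

triples-mono : ∀ {P Q : Word k → Word k → Word k → ℤ} → (∀ d c → P d (d ⊞ c) c ℤ.≤ Q d (d ⊞ c) c) → triples P ℤ.≤ triples Q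
triples-mono {k} le = ∑-mono (words k) λ c → ∑-mono (words k) λ d → le d c

-- The indicators of the weights 8 i with excess 6, 3 and 1.  The constants in φ and θ make excess³-bound an
-- equality when one of the three words is zero: the product is then 6·9 = 9 + 45, 6·1 or 6³ = 3·72.
e₆ e₃ e₁ φ : ℕ → ℤ
e₆ 0 = 1ℤ
e₆ _ = 0ℤ
e₃ 1 = 1ℤ
e₃ 6 = 1ℤ
e₃ _ = 0ℤ
e₁ 2 = 1ℤ
e₁ 5 = 1ℤ
e₁ _ = 0ℤ
φ i = + 45 * e₃ i + + 6 * e₁ i + + 72 * e₆ i

θ : ℕ → ℕ → ℤ
θ i j = + 9 * (e₃ i * e₃ j) + e₆ i * φ j

excess-split : ∀ {i} → i ℕ.< 7 → + excess 3 i ≡ + 6 * e₆ i + + 3 * e₃ i + e₁ i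
excess-split = from-yes (ℕ.allUpTo? (λ i → + excess 3 i ℤ.≟ + 6 * e₆ i + + 3 * e₃ i + e₁ i) 7)

excess²-split : ∀ {i} → i ℕ.< 7 → + excess 3 i * + excess 3 i ≡ + 36 * e₆ i + + 9 * e₃ i + e₁ i
excess²-split = from-yes (ℕ.allUpTo? (λ i → + excess 3 i * + excess 3 i ℤ.≟ + 36 * e₆ i + + 9 * e₃ i + e₁ i) 7)

-- A zero weight forces the two others to agree, and two weights with excess 3 exclude excess 0 for the third.
excess³-bound : ∀ {i} → i ℕ.< 7 → ∀ {j} → j ℕ.< 7 → ∀ {l} → l ℕ.< 7 →
  i ℕ.≤ j ℕ.+ l → j ℕ.≤ i ℕ.+ l → l ℕ.≤ i ℕ.+ j → i ℕ.+ j ℕ.+ l ℕ.≤ 14 →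
  θ i j + θ j l + θ l i ℤ.≤ + excess 3 i * + excess 3 j * + excess 3 l
excess³-bound = from-yes (ℕ.allUpTo? (λ i → ℕ.allUpTo? (λ j → ℕ.allUpTo? (λ l →
  (i ℕ.≤? j ℕ.+ l) →-dec (j ℕ.≤? i ℕ.+ l) →-dec (l ℕ.≤? i ℕ.+ j) →-dec (i ℕ.+ j ℕ.+ l ℕ.≤? 14) →-dec
  (θ i j + θ j l + θ l i ℤ.≤? + excess 3 i * + excess 3 j * + excess 3 l)) 7) 7) 7)

-- With e = 2 - m the two sign statements that follow concern products of consecutive integers: (e -
-- 1)(e - 2) = (m - 1) m and e (e - 1)(e - 2) = -(m - 2)(m - 1) m.
below-2 : ∀ e → e ℤ.≤ + 2 → ∃ λ m → e ≡ + 2 - + m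
below-2 e e≤2 = ℤ.∣ + 2 - e ∣ , trans (reflect e) (cong (_-_ (+ 2)) (sym (ℤ.0≤i⇒+∣i∣≡i (ℤ.i≤j⇒0≤j-i e≤2))))
  where
  reflect : ∀ e → e ≡ + 2 - (+ 2 - e)
  reflect = solve-∀

0≤[e-1][e-2] : ∀ e → e ℤ.≤ + 2 → 0ℤ ℤ.≤ (e - 1ℤ) * (e - + 2)
0≤[e-1][e-2] e e≤2 with below-2 e e≤2
... | zero        , refl = ℤ.≤-refl
... | suc m       , refl = subst (0ℤ ℤ.≤_) (trans (ℤ.pos-* m (suc m)) (expand (+ m))) (+≤+ z≤n)
  where
  expand : ∀ m → m * (1ℤ + m) ≡ (+ 2 - (1ℤ + m) - 1ℤ) * (+ 2 - (1ℤ + m) - + 2)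
  expand = solve-∀

e[e-1][e-2]≤0 : ∀ e → e ℤ.≤ + 2 → e * (e - 1ℤ) * (e - + 2) ℤ.≤ 0ℤ
e[e-1][e-2]≤0 e e≤2 with below-2 e e≤2
... | 0 , refl = ℤ.≤-refl
... | 1 , refl = ℤ.≤-refl
... | suc (suc m) , refl = subst (ℤ._≤ 0ℤ)
  (trans (cong -_ (trans (ℤ.pos-* (m ℕ.* suc m) (suc (suc m))) (cong (_* + suc (suc m)) (ℤ.pos-* m (suc m))))) (expand (+ m)))
  (ℤ.neg-mono-≤ (+≤+ z≤n))
  where
  expand : ∀ m → - (m * (1ℤ + m) * (+ 2 + m)) ≡ (+ 2 - (+ 2 + m)) * (+ 2 - (+ 2 + m) - 1ℤ) * (+ 2 - (+ 2 + m) - + 2)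
  expand = solve-∀

-- The second inequality is 9 α² + (β - 3)² ≤ 9, which leaves α = 0, β ≤ 6 and α = 1, β = 3. Among
-- these 6 + 3 α + β is a power of two only for α = 0, β = 2, and there 4 β ≤ β² fails. The proof
-- uses cruder bounds, which also bound k, and a finite search.
no-solution : ∀ k α β → 4 ℕ.* β ℕ.≤ (3 ℕ.* α ℕ.+ β) ℕ.* (3 ℕ.* α ℕ.+ β) → 9 ℕ.* (α ℕ.* α) ℕ.+ β ℕ.* β ℕ.≤ 6 ℕ.* β →
  2 ℕ.^ k ≢ 128 ℕ.* (6 ℕ.+ 3 ℕ.* α ℕ.+ β)
no-solution k α β low high 2^k≡ =
  from-yes (ℕ.allUpTo? (λ k → ℕ.allUpTo? (λ α → ℕ.allUpTo? (λ β →
    (4 ℕ.* β ℕ.≤? (3 ℕ.* α ℕ.+ β) ℕ.* (3 ℕ.* α ℕ.+ β)) →-dec (9 ℕ.* (α ℕ.* α) ℕ.+ β ℕ.* β ℕ.≤? 6 ℕ.* β) →-dec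
    ¬? (2 ℕ.^ k ℕ.≟ 128 ℕ.* (6 ℕ.+ 3 ℕ.* α ℕ.+ β))) 7) 3) 12)
    k<12 α<3 β<7 low high 2^k≡
  where
  β<7 : β ℕ.< 7
  β<7 = ℕ.≰⇒> λ 7≤β → ℕ.<⇒≱ (ℕ.*-monoˡ-< β {{ℕ.>-nonZero (ℕ.≤-trans (s≤s z≤n) 7≤β)}} (ℕ.n<1+n 6))
    (ℕ.≤-trans (ℕ.*-monoˡ-≤ β 7≤β) (ℕ.≤-trans (ℕ.m≤n+m (β ℕ.* β) (9 ℕ.* (α ℕ.* α))) high))
  α<3 : α ℕ.< 3
  α<3 = ℕ.≰⇒> λ 3≤α → ℕ.<⇒≱ {36} {81} (from-yes (36 ℕ.<? 81))
    (ℕ.≤-trans (ℕ.*-monoʳ-≤ 9 (ℕ.*-mono-≤ 3≤α 3≤α)) (ℕ.≤-trans (ℕ.m≤m+n _ (β ℕ.* β))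
      (ℕ.≤-trans high (ℕ.*-monoʳ-≤ 6 (ℕ.≤-pred β<7)))))
  k<12 : k ℕ.< 12
  k<12 = ℕ.≰⇒> λ 12≤k → ℕ.<⇒≱ {2304} {2 ℕ.^ 12} (from-yes (2304 ℕ.<? 2 ℕ.^ 12))
    (ℕ.≤-trans (ℕ.^-monoʳ-≤ 2 12≤k) (ℕ.≤-trans (ℕ.≤-reflexive 2^k≡)
      (ℕ.*-monoʳ-≤ 128 (ℕ.+-mono-≤ (ℕ.+-monoʳ-≤ 6 (ℕ.*-monoʳ-≤ 3 (ℕ.≤-pred α<3))) (ℕ.≤-pred β<7)))))

module Length59 {ps : List (Word k)} (code : IsCode ps) (len : length ps ≡ 59) where

  -- a = 3 gives s = -3 and 2 h = 59 + 9 - 64 = 4, so the integers `e q` are at most 2.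
  open Spectrum code 3 (+ 2) (cong (defect 3) (sym len))

  R = 2^ k

  j-⊞ : ∀ c d → j (c ⊞ d) ℕ.≤ j c ℕ.+ j d
  j-⊞ c d = ℕ.*-cancelʳ-≤ _ _ 8 (begin
    j (c ⊞ d) ℕ.* 8          ≡⟨ sym (wt≡ (c ⊞ d)) ⟩
    wt (c ⊞ d) ps            ≤⟨ wt-⊞ c d ps ⟩
    wt c ps ℕ.+ wt d ps      ≡⟨ cong₂ ℕ._+_ (wt≡ c) (wt≡ d) ⟩
    j c ℕ.* 8 ℕ.+ j d ℕ.* 8  ≡⟨ sym (ℕ.*-distribʳ-+ 8 (j c) (j d)) ⟩
    (j c ℕ.+ j d) ℕ.* 8      ∎)
    where open ℕ.≤-Reasoning

  -- The perimeter is at most 2 · 59 = 118 < 15 · 8, so the sum of the three j is less than 15.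
  j-perimeter : ∀ c d → j c ℕ.+ j d ℕ.+ j (c ⊞ d) ℕ.≤ 14
  j-perimeter c d = ℕ.≤-pred (ℕ.*-cancelʳ-< 8 _ 15 (begin-strict
    (j c ℕ.+ j d ℕ.+ j (c ⊞ d)) ℕ.* 8
      ≡⟨ trans (ℕ.*-distribʳ-+ 8 (j c ℕ.+ j d) (j (c ⊞ d))) (cong (ℕ._+ j (c ⊞ d) ℕ.* 8) (ℕ.*-distribʳ-+ 8 (j c) (j d))) ⟩
    j c ℕ.* 8 ℕ.+ j d ℕ.* 8 ℕ.+ j (c ⊞ d) ℕ.* 8
      ≡⟨ sym (cong₂ ℕ._+_ (cong₂ ℕ._+_ (wt≡ c) (wt≡ d)) (wt≡ (c ⊞ d))) ⟩
    wt c ps ℕ.+ wt d ps ℕ.+ wt (c ⊞ d) ps   ≤⟨ wt-perimeter c d ps ⟩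
    2 ℕ.* length ps                         ≡⟨ cong (2 ℕ.*_) len ⟩
    118                                     <⟨ from-yes (118 ℕ.<? 120) ⟩
    120                                     ∎))
    where open ℕ.≤-Reasoning

  -- No column is zero, so each coordinate is 1 in half of the words and the mean of 8 j is 59/2.
  mean : + 59 * R ≡ + 16 * ∑[ c ∈ W ] (+ j c)
  mean = ℤ.i-j≡0⇒i≡j _ _ (begin
    + 59 * R - + 16 * ∑[ c ∈ W ] (+ j c)
      ≡⟨ cong₂ _+_ (trans (ℤ.*-comm (+ 59) R) (sym (∑-words-const k (+ 59))))
           (trans (ℤ.neg-distribˡ-* (+ 16) _) (sym (∑-*ˡ W (- + 16) _))) ⟩
    ∑ W (λ _ → + 59) + ∑[ c ∈ W ] (- + 16 * + j c)
      ≡⟨ sym (∑-+ W _ _) ⟩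
    ∑[ c ∈ W ] (+ 59 + - + 16 * + j c)
      ≡⟨ ∑-cong W (λ c → sym (trans (∑-ψ c ps) (trans (cong₂ (λ l w → + l - + 2 * w) len
           (trans (cong +_ (wt≡ c)) (ℤ.pos-* (j c) 8))) (collect (+ j c))))) ⟩
    ∑[ c ∈ W ] ∑ ps (ψ c)
      ≡⟨ trans (∑-swap W ps _) (trans (∑-cong ps λ p → trans (orthogonality p) (ℤ.*-comm R (δ p))) (∑-*ʳ ps R δ)) ⟩
    ∑ ps δ * R
      ≡⟨ cong (_* R) (∑-vanish (All.map δ-≢𝟎 (IsCode.nonzero code))) ⟩
    0ℤ * R
      ≡⟨ ℤ.*-zeroˡ R ⟩
    0ℤ ∎)
    where
    open ≡-Reasoning
    collect : ∀ i → + 59 - + 2 * (i * + 8) ≡ + 59 + - + 16 * i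
    collect = solve-∀

  -- A word c of weight 56 would give wt d + wt (c ⊞ d) ≤ 56 for all d, while the mean weight is 59/2.
  j<7 : ∀ c → j c ℕ.< 7
  j<7 c = ℕ.≰⇒> λ 7≤j → ℤ.<⇒≱ {+ 56 * R} {+ 59 * R} (ℤ.*-monoʳ-<-pos R {{2^-positive k}} (+<+ (from-yes (56 ℕ.<? 59)))) (begin
    + 59 * R
      ≡⟨ mean ⟩
    + 16 * ∑[ d ∈ W ] (+ j d)
      ≡⟨ double (∑[ d ∈ W ] (+ j d)) ⟩
    + 8 * (∑[ d ∈ W ] (+ j d) + ∑[ d ∈ W ] (+ j d))
      ≡⟨ cong (λ t → + 8 * (∑[ d ∈ W ] (+ j d) + t)) (sym (∑-translate c (λ d → + j d))) ⟩
    + 8 * (∑[ d ∈ W ] (+ j d) + ∑[ d ∈ W ] (+ j (c ⊞ d)))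
      ≡⟨ cong (+ 8 *_) (sym (∑-+ W _ _)) ⟩
    + 8 * ∑[ d ∈ W ] (+ j d + + j (c ⊞ d))
      ≤⟨ ℤ.*-monoˡ-≤-nonNeg (+ 8) (∑-mono W λ d → +≤+ (ℕ.+-cancelˡ-≤ 7 _ _
           (ℕ.≤-trans (ℕ.+-monoˡ-≤ (j d ℕ.+ j (c ⊞ d)) 7≤j)
             (subst (ℕ._≤ 14) (ℕ.+-assoc (j c) (j d) _) (j-perimeter c d))))) ⟩
    + 8 * ∑ W (λ _ → + 7)
      ≡⟨ cong (+ 8 *_) (∑-words-const k (+ 7)) ⟩
    + 8 * (R * + 7)
      ≡⟨ collect R ⟩
    + 56 * R ∎)
    where
    open ℤ.≤-Reasoning
    double : ∀ t → + 16 * t ≡ + 8 * (t + t)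
    double = solve-∀
    collect : ∀ r → + 8 * (r * + 7) ≡ + 56 * r
    collect = solve-∀

  -- The number of words with excess 3 (weights 8 and 48), the number with excess 1 (weights 16 and
  -- 40), and the total excess.
  A₃ A₁ y : ℤ
  A₃ = ∑[ c ∈ W ] e₃ (j c)
  A₁ = ∑[ c ∈ W ] e₁ (j c)
  y = ∑ W E

  -- By `spanning`, 𝟎 is the only word of weight 0.
  ∑e₆≡1 : ∑[ c ∈ W ] e₆ (j c) ≡ 1ℤ
  ∑e₆≡1 = trans (∑-cong W λ c → trans (e₆≡δ c) (sym (ℤ.*-identityˡ (δ c)))) (∑-δ {k} (λ _ → 1ℤ))
    where
    e₆≡δ : ∀ c → e₆ (j c) ≡ δ c
    e₆≡δ c with j c in eq
    ... | zero  = sym (trans (cong δ (j≡0⇒𝟎 c eq)) (δ-𝟎 k))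
    ... | suc i = sym (δ-≢𝟎 {c = c} λ { refl → contradiction (trans (sym eq) j-𝟎) λ () })

  combination : ∀ α β γ → ∑[ c ∈ W ] (α * e₆ (j c) + β * e₃ (j c) + γ * e₁ (j c)) ≡ α * 1ℤ + β * A₃ + γ * A₁
  combination α β γ = trans (∑-+ W _ _) (cong₂ _+_ (trans (∑-+ W _ _) (cong₂ _+_
    (trans (∑-*ˡ W α _) (cong (α *_) ∑e₆≡1)) (∑-*ˡ W β _))) (∑-*ˡ W γ _))

  y≡ : y ≡ + 6 + + 3 * A₃ + A₁
  y≡ = trans (∑-cong W λ c → trans (excess-split (j<7 c)) (cong (_+_ (+ 6 * e₆ (j c) + + 3 * e₃ (j c))) (sym (ℤ.*-identityˡ (e₁ (j c))))))
    (trans (combination (+ 6) (+ 3) 1ℤ) (collect A₃ A₁))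
    where
    collect : ∀ a b → + 6 * 1ℤ + + 3 * a + 1ℤ * b ≡ + 6 + + 3 * a + b
    collect = solve-∀

  -- The values at 𝟎 of the twofold and threefold convolutions of `E`, which are the second and
  -- third moments of its transform up to the factor 2ᵏ.
  S₂ S₃ : ℤ
  S₂ = ∑[ c ∈ W ] (E c * E c)
  S₃ = triples (λ u v w → E u * E v * E w)

  S₂≡ : S₂ ≡ + 36 + + 9 * A₃ + A₁
  S₂≡ = trans (∑-cong W λ c → trans (excess²-split (j<7 c)) (cong (_+_ (+ 36 * e₆ (j c) + + 9 * e₃ (j c))) (sym (ℤ.*-identityˡ (e₁ (j c))))))
    (trans (combination (+ 36) (+ 9) 1ℤ) (collect A₃ A₁))
    where
    collect : ∀ a b → + 36 * 1ℤ + + 9 * a + 1ℤ * b ≡ + 36 + + 9 * a + b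
    collect = solve-∀

  -- `excess³-bound` is summed over all triples with sum 𝟎. Its hypotheses are the triangle
  -- inequalities, with each word written as the sum of the other two, and the perimeter bound.
  S₃≥ : + 3 * (+ 9 * (A₃ * A₃) + (+ 45 * A₃ + + 6 * A₁ + + 72)) ℤ.≤ S₃
  S₃≥ = begin
    + 3 * (+ 9 * (A₃ * A₃) + (+ 45 * A₃ + + 6 * A₁ + + 72))
      ≡⟨ cong (+ 3 *_) (sym ∑∑θ) ⟩
    + 3 * ∑[ u ∈ W ] ∑[ v ∈ W ] Θ u v
      ≡⟨ sym (triples-cyclic Θ) ⟩
    triples (λ u v w → Θ u v + Θ v w + Θ w u)
      ≤⟨ triples-mono {P = λ u v w → Θ u v + Θ v w + Θ w u} {Q = λ u v w → E u * E v * E w} (λ d c →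
           excess³-bound (j<7 d) (j<7 (d ⊞ c)) (j<7 c)
             (subst (λ v → j v ℕ.≤ j (d ⊞ c) ℕ.+ j c) (⊞-cancelʳ d c) (j-⊞ (d ⊞ c) c))
             (j-⊞ d c)
             (subst (λ v → j v ℕ.≤ j d ℕ.+ j (d ⊞ c)) (⊞-cancel d c) (j-⊞ d (d ⊞ c)))
             (subst (λ v → j d ℕ.+ j (d ⊞ c) ℕ.+ j v ℕ.≤ 14) (⊞-cancel d c) (j-perimeter d (d ⊞ c)))) ⟩
    S₃ ∎
    where
    open ℤ.≤-Reasoning
    Θ : Word k → Word k → ℤ
    Θ u v = θ (j u) (j v)
    ∑φ : ∑[ v ∈ W ] φ (j v) ≡ + 45 * A₃ + + 6 * A₁ + + 72
    ∑φ = trans (∑-cong W λ c → rotate (e₃ (j c)) (e₁ (j c)) (e₆ (j c)))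
      (trans (combination (+ 72) (+ 45) (+ 6)) (collect A₃ A₁))
      where
      rotate : ∀ s t u → + 45 * s + + 6 * t + + 72 * u ≡ + 72 * u + + 45 * s + + 6 * t
      rotate = solve-∀
      collect : ∀ a b → + 72 * 1ℤ + + 45 * a + + 6 * b ≡ + 45 * a + + 6 * b + + 72
      collect = solve-∀
    ∑∑θ : ∑[ u ∈ W ] ∑[ v ∈ W ] Θ u v ≡ + 9 * (A₃ * A₃) + (+ 45 * A₃ + + 6 * A₁ + + 72)
    ∑∑θ = trans (∑-cong W λ u → ∑-+ W _ _) (trans (∑-+ W _ _) (cong₂ _+_
      (trans (∑-cong W λ u → ∑-*ˡ W (+ 9) _) (trans (∑-*ˡ W (+ 9) _) (cong (+ 9 *_) (∑-* W W (e₃ ∘ j) (e₃ ∘ j)))))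
      (trans (∑-* W W (e₆ ∘ j) (φ ∘ j)) (trans (cong₂ _*_ ∑e₆≡1 ∑φ) (ℤ.*-identityˡ _)))))

  F : Word k → ℤ
  F = hat E

  R≡128y : R ≡ + 128 * y
  R≡128y = ℤ.*-cancelʳ-≡ R (+ 128 * y) (+ 2) (trans (sym total) (halve y))
    where
    halve : ∀ y → + 256 * y ≡ + 128 * y * + 2
    halve = solve-∀

  -- Replacing 2ᵏ by 128 y in `spectrum` turns polynomials in `e` with roots 0, 1, 2 into
  -- polynomials in 2 F with roots 0, y, 2 y.
  2F≡ye : ∀ q → + 2 * F q ≡ y * e q
  2F≡ye q = ℤ.*-cancelˡ-≡ (+ 128) _ _ (trans (sym (ℤ.*-assoc (+ 128) (+ 2) (F q)))
    (trans (spectrum q) (trans (cong (_* e q) R≡128y) (ℤ.*-assoc (+ 128) y (e q)))))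

  0≤y : 0ℤ ℤ.≤ y
  0≤y = ∑-nonneg W λ c → +≤+ z≤n

  E-𝟎 : E 𝟎 ≡ + 6
  E-𝟎 = cong (λ i → + excess 3 i) j-𝟎

  ∑F ∑F² ∑F³ : ℤ
  ∑F  = ∑ W F
  ∑F² = ∑[ q ∈ W ] (F q * F q)
  ∑F³ = ∑[ q ∈ W ] (F q * F q * F q)

  -- The sum over q of y² (e - 1)(e - 2), written in `F` and evaluated by inversion at 𝟎 and
  -- Parseval; the 36 is 6 · E 𝟎.
  quadratic≥0 : 0ℤ ℤ.≤ + 4 * S₂ - + 36 * y + + 2 * (y * y)
  quadratic≥0 = ℤ.*-cancelˡ-≤-pos 0ℤ _ R {{2^-positive k}} (begin
    R * 0ℤ
      ≡⟨ ℤ.*-zeroʳ R ⟩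
    0ℤ
      ≤⟨ ∑-nonneg W pointwise ⟩
    ∑[ q ∈ W ] ((+ 2 * F q - y) * (+ 2 * F q - + 2 * y))
      ≡⟨ ∑-cong W (λ q → expand (F q) y) ⟩
    ∑[ q ∈ W ] (+ 4 * (F q * F q) + - (+ 6 * y) * F q + + 2 * (y * y))
      ≡⟨ trans (∑-+ W _ _) (cong₂ _+_ (trans (∑-+ W _ _) (cong₂ _+_ (∑-*ˡ W (+ 4) _) (∑-*ˡ W (- (+ 6 * y)) F)))
           (∑-words-const k (+ 2 * (y * y)))) ⟩
    + 4 * ∑F² + - (+ 6 * y) * ∑F + R * (+ 2 * (y * y))
      ≡⟨ cong₂ (λ s t → + 4 * s + - (+ 6 * y) * t + R * (+ 2 * (y * y))) (∑-hat² E) (trans (∑-hat E) (cong (R *_) E-𝟎)) ⟩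
    + 4 * (R * S₂) + - (+ 6 * y) * (R * + 6) + R * (+ 2 * (y * y))
      ≡⟨ collect R S₂ y ⟩
    R * (+ 4 * S₂ - + 36 * y + + 2 * (y * y)) ∎)
    where
    open ℤ.≤-Reasoning
    expand : ∀ f y → (+ 2 * f - y) * (+ 2 * f - + 2 * y) ≡ + 4 * (f * f) + - (+ 6 * y) * f + + 2 * (y * y)
    expand = solve-∀
    collect : ∀ r s y → + 4 * (r * s) + - (+ 6 * y) * (r * + 6) + r * (+ 2 * (y * y)) ≡ r * (+ 4 * s - + 36 * y + + 2 * (y * y))
    collect = solve-∀
    factor : ∀ y e → (y * e - y) * (y * e - + 2 * y) ≡ y * (y * ((e - 1ℤ) * (e - + 2)))
    factor = solve-∀
    pointwise : ∀ q → 0ℤ ℤ.≤ (+ 2 * F q - y) * (+ 2 * F q - + 2 * y)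
    pointwise q = subst (0ℤ ℤ.≤_)
      (sym (trans (cong (λ t → (t - y) * (t - + 2 * y)) (2F≡ye q)) (factor y (e q))))
      (*-nonneg 0≤y (*-nonneg 0≤y (0≤[e-1][e-2] (e q) (e≤h q))))
      where
      *-nonneg : ∀ {i j} → 0ℤ ℤ.≤ i → 0ℤ ℤ.≤ j → 0ℤ ℤ.≤ i * j
      *-nonneg {i} 0≤i 0≤j = subst (ℤ._≤ i * _) (ℤ.*-zeroʳ i) (ℤ.*-monoˡ-≤-nonNeg i {{ℤ.nonNegative 0≤i}} 0≤j)

  -- The sum over q of y³ e (e - 1)(e - 2), evaluated by the first three moments of `F`; the 24 is 4
  -- · E 𝟎.
  cubic≤0 : + 8 * S₃ - + 12 * y * S₂ + + 24 * (y * y) ℤ.≤ 0ℤ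
  cubic≤0 = ℤ.*-cancelˡ-≤-pos _ 0ℤ R {{2^-positive k}} (begin
    R * (+ 8 * S₃ - + 12 * y * S₂ + + 24 * (y * y))
      ≡⟨ collect R S₂ S₃ y ⟩
    + 8 * (R * S₃) + - (+ 12 * y) * (R * S₂) + + 4 * (y * y) * (R * + 6)
      ≡⟨ sym (trans (cong (λ s → + 8 * ∑F³ + - (+ 12 * y) * ∑F² + + 4 * (y * y) * s) (trans (∑-hat E) (cong (R *_) E-𝟎)))
           (cong₂ (λ s t → + 8 * s + - (+ 12 * y) * t + + 4 * (y * y) * (R * + 6)) (∑-hat³ E) (∑-hat² E))) ⟩
    + 8 * ∑F³ + - (+ 12 * y) * ∑F² + + 4 * (y * y) * ∑F
      ≡⟨ sym (trans (∑-+ W _ _) (cong₂ _+_ (trans (∑-+ W _ _) (cong₂ _+_ (∑-*ˡ W (+ 8) _) (∑-*ˡ W (- (+ 12 * y)) _)))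
           (∑-*ˡ W (+ 4 * (y * y)) F))) ⟩
    ∑[ q ∈ W ] (+ 8 * (F q * F q * F q) + - (+ 12 * y) * (F q * F q) + + 4 * (y * y) * F q)
      ≡⟨ ∑-cong W (λ q → sym (expand (F q) y)) ⟩
    ∑[ q ∈ W ] (+ 2 * F q * (+ 2 * F q - y) * (+ 2 * F q - + 2 * y))
      ≤⟨ ∑-mono W pointwise ⟩
    ∑ W (λ _ → 0ℤ)
      ≡⟨ trans (∑-0 W) (sym (ℤ.*-zeroʳ R)) ⟩
    R * 0ℤ ∎)
    where
    open ℤ.≤-Reasoning
    expand : ∀ f y → + 2 * f * (+ 2 * f - y) * (+ 2 * f - + 2 * y) ≡
      + 8 * (f * f * f) + - (+ 12 * y) * (f * f) + + 4 * (y * y) * f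
    expand = solve-∀
    collect : ∀ r s t y → r * (+ 8 * t - + 12 * y * s + + 24 * (y * y)) ≡
      + 8 * (r * t) + - (+ 12 * y) * (r * s) + + 4 * (y * y) * (r * + 6)
    collect = solve-∀
    factor : ∀ y e → y * e * (y * e - y) * (y * e - + 2 * y) ≡ y * (y * (y * (e * (e - 1ℤ) * (e - + 2))))
    factor = solve-∀
    pointwise : ∀ q → + 2 * F q * (+ 2 * F q - y) * (+ 2 * F q - + 2 * y) ℤ.≤ 0ℤ
    pointwise q = subst (ℤ._≤ 0ℤ)
      (sym (trans (cong (λ t → t * (t - y) * (t - + 2 * y)) (2F≡ye q)) (factor y (e q))))
      (*-nonpos (*-nonpos (*-nonpos (e[e-1][e-2]≤0 (e q) (e≤h q)))))
      where
      *-nonpos : ∀ {j} → j ℤ.≤ 0ℤ → y * j ℤ.≤ 0ℤ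
      *-nonpos {j} j≤0 = subst (y * j ℤ.≤_) (ℤ.*-zeroʳ y) (ℤ.*-monoˡ-≤-nonNeg y {{ℤ.nonNegative 0≤y}} j≤0)

  4A₁≤ : + 4 * A₁ ℤ.≤ (+ 3 * A₃ + A₁) * (+ 3 * A₃ + A₁)
  4A₁≤ = ℤ.*-cancelˡ-≤-pos (+ 4 * A₁) _ (+ 2) (ℤ.0≤i-j⇒j≤i (subst (0ℤ ℤ.≤_)
    (trans (cong₂ (λ s y → + 4 * s - + 36 * y + + 2 * (y * y)) S₂≡ y≡) (expand A₃ A₁)) quadratic≥0))
    where
    expand : ∀ a b → let y = + 6 + + 3 * a + b in
      + 4 * (+ 36 + + 9 * a + b) - + 36 * y + + 2 * (y * y) ≡ + 2 * ((+ 3 * a + b) * (+ 3 * a + b)) - + 2 * (+ 4 * b)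
    expand = solve-∀

  -- When `S₃≥` is inserted in `cubic≤0`, the constant terms, the terms linear in A₃ and the mixed
  -- terms cancel, and a factor 12 remains.
  ≤6A₁ : + 9 * (A₃ * A₃) + A₁ * A₁ ℤ.≤ + 6 * A₁
  ≤6A₁ = ℤ.*-cancelˡ-≤-pos _ (+ 6 * A₁) (+ 12) (ℤ.i-j≤0⇒i≤j (begin
    + 12 * (+ 9 * (A₃ * A₃) + A₁ * A₁) - + 12 * (+ 6 * A₁)
      ≡⟨ expand A₃ A₁ ⟩
    + 8 * L - + 12 * (+ 6 + + 3 * A₃ + A₁) * (+ 36 + + 9 * A₃ + A₁) + + 24 * ((+ 6 + + 3 * A₃ + A₁) * (+ 6 + + 3 * A₃ + A₁))
      ≡⟨ cong₂ (λ y s → + 8 * L - + 12 * y * s + + 24 * (y * y)) (sym y≡) (sym S₂≡) ⟩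
    + 8 * L - + 12 * y * S₂ + + 24 * (y * y)
      ≤⟨ ℤ.+-monoˡ-≤ (+ 24 * (y * y)) (ℤ.+-monoˡ-≤ (- (+ 12 * y * S₂)) (ℤ.*-monoˡ-≤-nonNeg (+ 8) S₃≥)) ⟩
    + 8 * S₃ - + 12 * y * S₂ + + 24 * (y * y)
      ≤⟨ cubic≤0 ⟩
    0ℤ ∎))
    where
    open ℤ.≤-Reasoning
    L = + 3 * (+ 9 * (A₃ * A₃) + (+ 45 * A₃ + + 6 * A₁ + + 72))
    expand : ∀ a b → let y = + 6 + + 3 * a + b in
      + 12 * (+ 9 * (a * a) + b * b) - + 12 * (+ 6 * b) ≡
      + 8 * (+ 3 * (+ 9 * (a * a) + (+ 45 * a + + 6 * b + + 72))) - + 12 * y * (+ 36 + + 9 * a + b) + + 24 * (y * y)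
    expand = solve-∀

  e₃-nonneg : ∀ {i} → i ℕ.< 7 → 0ℤ ℤ.≤ e₃ i
  e₃-nonneg = from-yes (ℕ.allUpTo? (λ i → 0ℤ ℤ.≤? e₃ i) 7)

  e₁-nonneg : ∀ {i} → i ℕ.< 7 → 0ℤ ℤ.≤ e₁ i
  e₁-nonneg = from-yes (ℕ.allUpTo? (λ i → 0ℤ ℤ.≤? e₁ i) 7)

  α β : ℕ
  α = ℤ.∣ A₃ ∣
  β = ℤ.∣ A₁ ∣

  A₃≡ : A₃ ≡ + α
  A₃≡ = sym (ℤ.0≤i⇒+∣i∣≡i (∑-nonneg W λ c → e₃-nonneg (j<7 c)))

  A₁≡ : A₁ ≡ + β
  A₁≡ = sym (ℤ.0≤i⇒+∣i∣≡i (∑-nonneg W λ c → e₁-nonneg (j<7 c)))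

  absurd : ⊥
  absurd = no-solution k α β
    (ℤ.drop‿+≤+ (subst₂ ℤ._≤_
      (trans (cong (+ 4 *_) A₁≡) (sym (ℤ.pos-* 4 β)))
      (trans (cong₂ (λ a b → (+ 3 * a + b) * (+ 3 * a + b)) A₃≡ A₁≡)
        (trans (cong (λ t → (t + + β) * (t + + β)) (sym (ℤ.pos-* 3 α))) (sym (ℤ.pos-* (3 ℕ.* α ℕ.+ β) _))))
      4A₁≤))
    (ℤ.drop‿+≤+ (subst₂ ℤ._≤_
      (trans (cong₂ (λ a b → + 9 * (a * a) + b * b) A₃≡ A₁≡) (cong₂ _+_
        (trans (cong (+ 9 *_) (sym (ℤ.pos-* α α))) (sym (ℤ.pos-* 9 (α ℕ.* α)))) (sym (ℤ.pos-* β β))))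
      (trans (cong (+ 6 *_) A₁≡) (sym (ℤ.pos-* 6 β)))
      ≤6A₁))
    (ℤ.+-injective (trans R≡128y (trans (cong (+ 128 *_) (trans y≡ (trans (cong₂ (λ a b → + 6 + + 3 * a + b) A₃≡ A₁≡)
      (cong (λ t → + 6 + t + + β) (sym (ℤ.pos-* 3 α)))))) (sym (ℤ.pos-* 128 (6 ℕ.+ 3 ℕ.* α ℕ.+ β))))))

-- Constructions

padʳ : ∀ {k} l → Word k → Word (k ℕ.+ l)
padʳ l p = p Vec.++ 𝟎

padˡ : ∀ k {l} → Word l → Word (k ℕ.+ l)
padˡ k p = 𝟎 {k} Vec.++ p

dot-++ : ∀ {k l} (c p : Word k) (d q : Word l) → dot (c Vec.++ d) (p Vec.++ q) ≡ dot c p xor dot d q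
dot-++ []      []      d q = refl
dot-++ (a ∷ c) (b ∷ p) d q = trans (cong ((a ∧ b) xor_) (dot-++ c p d q)) (sym (Bool.xor-assoc (a ∧ b) (dot c p) (dot d q)))

wt-++ : ∀ {k} (c : Word k) ps qs → wt c (ps ++ qs) ≡ wt c ps ℕ.+ wt c qs
wt-++ c []       qs = refl
wt-++ c (p ∷ ps) qs = trans (cong (b2n (dot c p) ℕ.+_) (wt-++ c ps qs)) (sym (ℕ.+-assoc (b2n (dot c p)) _ _))

wt-map : ∀ {k l} (c : Word k) (d : Word l) (f : Word l → Word k) → (∀ p → dot c (f p) ≡ dot d p) →
  ∀ ps → wt c (List.map f ps) ≡ wt d ps
wt-map c d f e []       = refl
wt-map c d f e (p ∷ ps) = cong₂ ℕ._+_ (cong b2n (e p)) (wt-map c d f e ps)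

𝟎-++ : ∀ k {l} → 𝟎 {k} Vec.++ 𝟎 {l} ≡ 𝟎
𝟎-++ zero    = refl
𝟎-++ (suc k) = cong (false ∷_) (𝟎-++ k)

infixr 6 _⊕ᶜ_
-- The direct sum: columns are padded by zeros in the other block, so weights add. A common column
-- would vanish in its first block, contrary to `nonzero` for `ps`.
_⊕ᶜ_ : ∀ {m n} → Code m → Code n → Code (m ℕ.+ n)
_⊕ᶜ_ {m} {n} (k , ps , P , lp) (l , qs , Q , lq) = k ℕ.+ l , ps′ ++ qs′ , code ,
  trans (List.length-++ ps′) (cong₂ ℕ._+_ (trans (List.length-map _ ps) lp) (trans (List.length-map _ qs) lq))
  where
  module P = IsCode P
  module Q = IsCode Q
  ps′ = List.map (padʳ l) ps
  qs′ = List.map (padˡ k) qs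

  weight≡ : ∀ c d → wt (c Vec.++ d) (ps′ ++ qs′) ≡ wt c ps ℕ.+ wt d qs
  weight≡ c d = trans (wt-++ (c Vec.++ d) ps′ qs′) (cong₂ ℕ._+_
    (wt-map _ c _ (λ p → trans (dot-++ c p d 𝟎) (trans (cong (dot c p xor_) (dot-𝟎ʳ d)) (Bool.xor-identityʳ (dot c p)))) ps)
    (wt-map _ d _ (λ q → trans (dot-++ c 𝟎 d q) (cong (_xor dot d q) (dot-𝟎ʳ c))) qs))

  disjoint : ∀ {v} → ¬ (v ∈ ps′ × v ∈ qs′)
  disjoint (v∈ps′ , v∈qs′) with ∈.∈-map⁻ (padʳ l) v∈ps′ | ∈.∈-map⁻ (padˡ k) v∈qs′
  ... | p , p∈ps , refl | q , q∈qs , e = All.lookup P.nonzero p∈ps (Vec.++-injectiveˡ p 𝟎 e)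

  div : ∀ c → 8 ∣ wt c (ps′ ++ qs′)
  div c with Vec.splitAt k c
  ... | c₁ , c₂ , refl = subst (8 ∣_) (sym (weight≡ c₁ c₂)) (∣m∣n⇒∣m+n (P.divisible c₁) (Q.divisible c₂))

  span : ∀ c → wt c (ps′ ++ qs′) ≡ 0 → c ≡ 𝟎
  span c e with Vec.splitAt k c
  ... | c₁ , c₂ , refl with trans (sym (weight≡ c₁ c₂)) e
  ...   | e′ = trans (cong₂ Vec._++_ (P.spanning c₁ (ℕ.m+n≡0⇒m≡0 (wt c₁ ps) e′))
                                     (Q.spanning c₂ (ℕ.m+n≡0⇒n≡0 (wt c₁ ps) e′))) (𝟎-++ k)

  code : IsCode (ps′ ++ qs′)
  code = record
    { unique    = Unique.++⁺ (Unique.map⁺ (λ {p} {q} → Vec.++-injectiveˡ p q) P.unique)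
                             (Unique.map⁺ (λ {p} {q} → Vec.++-injectiveʳ 𝟎 𝟎) Q.unique) disjoint
    ; nonzero   = All.++⁺ (All.map⁺ (All.map (λ ne e → ne (Vec.++-injectiveˡ _ 𝟎 (trans e (sym (𝟎-++ k))))) P.nonzero))
                          (All.map⁺ (All.map (λ ne e → ne (Vec.++-injectiveʳ 𝟎 𝟎 (trans e (sym (𝟎-++ k))))) Q.nonzero))
    ; divisible = div
    ; spanning  = span
    }

-- Verification of explicit codes by computation.

all-words? : ∀ {k} {P : Word k → Set} → (∀ c → Dec (P c)) → Dec (∀ c → P c)
all-words? {zero}  P? = map′ (λ { p [] → p }) (λ p → p []) (P? [])
all-words? {suc k} P? = map′ (λ { (f , t) (false ∷ c) → f c ; (f , t) (true ∷ c) → t c })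
  (λ p → (λ c → p (false ∷ c)) , (λ c → p (true ∷ c)))
  (all-words? (λ c → P? (false ∷ c)) ×-dec all-words? (λ c → P? (true ∷ c)))

_≟ʷ_ : ∀ {k} (c d : Word k) → Dec (c ≡ d)
_≟ʷ_ = Vec.≡-dec Bool._≟_

isCode? : ∀ {k} (ps : List (Word k)) → Dec (IsCode ps)
isCode? ps = map′
  (λ { (u , z , d) → record { unique = u ; nonzero = z ; divisible = proj₁ ∘ d ; spanning = proj₂ ∘ d } })
  (λ c → let open IsCode c in unique , nonzero , λ c → divisible c , spanning c)
  (AP.allPairs? (λ c d → ¬? (c ≟ʷ d)) ps ×-dec All.all? (λ c → ¬? (c ≟ʷ 𝟎)) ps ×-dec
   all-words? (λ c → (8 ∣? wt c ps) ×-dec ((wt c ps ℕ.≟ 0) →-dec (c ≟ʷ 𝟎))))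

binary : ∀ k → ℕ → Word k
binary zero    n = []
binary (suc k) n = (n ℕ.% 2 ℕ.≡ᵇ 1) ∷ binary k (n ℕ./ 2)

-- A number stands for the column of its binary digits, the least significant first. The implicit
-- argument is settled by evaluating `isCode?` over all 2ᵏ words.
listed : ∀ k (ns : List ℕ) → {True (isCode? (List.map (binary k) ns))} → Code (length ns)
listed k ns {ok} = k , List.map (binary k) ns , toWitness ok , List.length-map (binary k) ns

code15 : Code 15
code15 = listed 4 (
  1 ∷ 2 ∷ 3 ∷ 4 ∷ 5 ∷ 6 ∷ 7 ∷ 8 ∷ 9 ∷ 10 ∷ 11 ∷ 12 ∷ 13 ∷ 14 ∷ 15 ∷ [])

code16 : Code 16
code16 = listed 5 (
  16 ∷ 17 ∷ 18 ∷ 19 ∷ 20 ∷ 21 ∷ 22 ∷ 23 ∷ 24 ∷ 25 ∷ 26 ∷ 27 ∷ 28 ∷ 29 ∷ 30 ∷ 31 ∷ [])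

-- In the following, 51 is the set of fifth powers in F₂₅₆ and 68 a union of four cosets of the 17th roots of unity.
-- 70 is a hyperoval of PG(2,8), read as ten disjoint planes over F₂; trading i of these planes for affine solids
-- with the same planes at infinity gives 70 + i.  49, 50 and 69 were found by computer search.
code49 : Code 49
code49 = listed 8 (
  1 ∷ 2 ∷ 4 ∷ 7 ∷ 10 ∷ 11 ∷ 16 ∷ 38 ∷ 55 ∷ 57 ∷ 58 ∷ 60 ∷ 63 ∷ 66 ∷ 72 ∷ 73 ∷ 80 ∷ 81 ∷ 83 ∷ 98 ∷
  99 ∷ 101 ∷ 112 ∷ 113 ∷ 116 ∷ 128 ∷ 129 ∷ 135 ∷ 146 ∷ 147 ∷ 150 ∷ 160 ∷ 170 ∷ 171 ∷ 177 ∷ 178 ∷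
  179 ∷ 196 ∷ 213 ∷ 217 ∷ 218 ∷ 220 ∷ 223 ∷ 225 ∷ 228 ∷ 231 ∷ 232 ∷ 233 ∷ 242 ∷ [])

code50 : Code 50
code50 = listed 8 (
  2 ∷ 9 ∷ 12 ∷ 20 ∷ 23 ∷ 24 ∷ 25 ∷ 28 ∷ 33 ∷ 37 ∷ 41 ∷ 51 ∷ 59 ∷ 60 ∷ 64 ∷ 65 ∷ 68 ∷ 71 ∷ 73 ∷ 82
  ∷ 96 ∷ 108 ∷ 109 ∷ 112 ∷ 118 ∷ 126 ∷ 135 ∷ 145 ∷ 151 ∷ 153 ∷ 156 ∷ 157 ∷ 168 ∷ 169 ∷ 172 ∷ 183 ∷
  185 ∷ 186 ∷ 192 ∷ 194 ∷ 200 ∷ 204 ∷ 205 ∷ 210 ∷ 224 ∷ 228 ∷ 229 ∷ 242 ∷ 245 ∷ 255 ∷ [])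

code51 : Code 51
code51 = listed 8 (
  1 ∷ 3 ∷ 5 ∷ 15 ∷ 17 ∷ 26 ∷ 28 ∷ 32 ∷ 36 ∷ 38 ∷ 44 ∷ 46 ∷ 51 ∷ 55 ∷ 59 ∷ 77 ∷ 85 ∷ 89 ∷ 94 ∷ 96 ∷
  100 ∷ 103 ∷ 106 ∷ 108 ∷ 114 ∷ 116 ∷ 124 ∷ 132 ∷ 145 ∷ 150 ∷ 156 ∷ 160 ∷ 167 ∷ 169 ∷ 172 ∷ 174 ∷
  180 ∷ 185 ∷ 190 ∷ 193 ∷ 214 ∷ 215 ∷ 223 ∷ 226 ∷ 230 ∷ 233 ∷ 235 ∷ 239 ∷ 244 ∷ 253 ∷ 255 ∷ [])

code68 : Code 68
code68 = listed 8 (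
  1 ∷ 2 ∷ 7 ∷ 8 ∷ 15 ∷ 20 ∷ 26 ∷ 30 ∷ 33 ∷ 36 ∷ 38 ∷ 39 ∷ 42 ∷ 44 ∷ 45 ∷ 49 ∷ 52 ∷ 59 ∷ 61 ∷ 63 ∷
  70 ∷ 72 ∷ 74 ∷ 76 ∷ 79 ∷ 85 ∷ 88 ∷ 89 ∷ 96 ∷ 100 ∷ 111 ∷ 112 ∷ 118 ∷ 120 ∷ 123 ∷ 125 ∷ 128 ∷ 129
  ∷ 131 ∷ 145 ∷ 146 ∷ 150 ∷ 155 ∷ 159 ∷ 161 ∷ 163 ∷ 169 ∷ 170 ∷ 175 ∷ 178 ∷ 182 ∷ 185 ∷ 192 ∷ 193
  ∷ 194 ∷ 196 ∷ 197 ∷ 200 ∷ 204 ∷ 208 ∷ 211 ∷ 213 ∷ 220 ∷ 223 ∷ 234 ∷ 242 ∷ 247 ∷ 252 ∷ [])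

code69 : Code 69
code69 = listed 9 (
  1 ∷ 3 ∷ 5 ∷ 12 ∷ 14 ∷ 18 ∷ 35 ∷ 39 ∷ 46 ∷ 47 ∷ 48 ∷ 54 ∷ 58 ∷ 73 ∷ 75 ∷ 85 ∷ 94 ∷ 95 ∷ 97 ∷ 98 ∷
  102 ∷ 108 ∷ 118 ∷ 121 ∷ 126 ∷ 128 ∷ 138 ∷ 143 ∷ 144 ∷ 146 ∷ 150 ∷ 155 ∷ 169 ∷ 170 ∷ 174 ∷ 183 ∷
  190 ∷ 192 ∷ 214 ∷ 221 ∷ 228 ∷ 234 ∷ 237 ∷ 251 ∷ 253 ∷ 282 ∷ 296 ∷ 302 ∷ 306 ∷ 327 ∷ 335 ∷ 340 ∷
  347 ∷ 348 ∷ 362 ∷ 367 ∷ 368 ∷ 389 ∷ 397 ∷ 399 ∷ 405 ∷ 406 ∷ 413 ∷ 414 ∷ 425 ∷ 461 ∷ 471 ∷ 476 ∷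
  488 ∷ [])

code70 : Code 70
code70 = listed 9 (
  1 ∷ 2 ∷ 3 ∷ 4 ∷ 5 ∷ 6 ∷ 7 ∷ 8 ∷ 16 ∷ 24 ∷ 32 ∷ 40 ∷ 48 ∷ 56 ∷ 64 ∷ 73 ∷ 84 ∷ 93 ∷ 102 ∷ 111 ∷
  114 ∷ 123 ∷ 128 ∷ 141 ∷ 146 ∷ 159 ∷ 163 ∷ 174 ∷ 177 ∷ 188 ∷ 192 ∷ 206 ∷ 213 ∷ 219 ∷ 226 ∷ 236 ∷
  247 ∷ 249 ∷ 256 ∷ 271 ∷ 273 ∷ 286 ∷ 292 ∷ 299 ∷ 309 ∷ 314 ∷ 320 ∷ 330 ∷ 339 ∷ 345 ∷ 359 ∷ 365 ∷
  372 ∷ 382 ∷ 384 ∷ 395 ∷ 407 ∷ 412 ∷ 417 ∷ 426 ∷ 438 ∷ 445 ∷ 448 ∷ 460 ∷ 470 ∷ 474 ∷ 485 ∷ 489 ∷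
  499 ∷ 511 ∷ [])

code71 : Code 71
code71 = listed 10 (
  8 ∷ 16 ∷ 24 ∷ 32 ∷ 40 ∷ 48 ∷ 56 ∷ 64 ∷ 73 ∷ 84 ∷ 93 ∷ 102 ∷ 111 ∷ 114 ∷ 123 ∷ 128 ∷ 141 ∷ 146 ∷
  159 ∷ 163 ∷ 174 ∷ 177 ∷ 188 ∷ 192 ∷ 206 ∷ 213 ∷ 219 ∷ 226 ∷ 236 ∷ 247 ∷ 249 ∷ 256 ∷ 271 ∷ 273 ∷
  286 ∷ 292 ∷ 299 ∷ 309 ∷ 314 ∷ 320 ∷ 330 ∷ 339 ∷ 345 ∷ 359 ∷ 365 ∷ 372 ∷ 382 ∷ 384 ∷ 395 ∷ 407 ∷
  412 ∷ 417 ∷ 426 ∷ 438 ∷ 445 ∷ 448 ∷ 460 ∷ 470 ∷ 474 ∷ 485 ∷ 489 ∷ 499 ∷ 511 ∷ 512 ∷ 513 ∷ 514 ∷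
  515 ∷ 516 ∷ 517 ∷ 518 ∷ 519 ∷ [])

code72 : Code 72
code72 = listed 10 (
  8 ∷ 16 ∷ 24 ∷ 32 ∷ 40 ∷ 48 ∷ 56 ∷ 64 ∷ 84 ∷ 93 ∷ 102 ∷ 111 ∷ 114 ∷ 123 ∷ 128 ∷ 141 ∷ 159 ∷ 163 ∷
  174 ∷ 177 ∷ 188 ∷ 192 ∷ 206 ∷ 213 ∷ 226 ∷ 236 ∷ 247 ∷ 249 ∷ 256 ∷ 271 ∷ 273 ∷ 286 ∷ 299 ∷ 309 ∷
  314 ∷ 320 ∷ 330 ∷ 339 ∷ 345 ∷ 359 ∷ 372 ∷ 382 ∷ 384 ∷ 395 ∷ 407 ∷ 412 ∷ 417 ∷ 426 ∷ 445 ∷ 448 ∷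
  460 ∷ 470 ∷ 474 ∷ 485 ∷ 489 ∷ 499 ∷ 512 ∷ 513 ∷ 514 ∷ 515 ∷ 516 ∷ 517 ∷ 518 ∷ 519 ∷ 520 ∷ 577 ∷
  666 ∷ 723 ∷ 812 ∷ 869 ∷ 958 ∷ 1015 ∷ [])

code73 : Code 73
code73 = listed 10 (
  8 ∷ 16 ∷ 24 ∷ 32 ∷ 40 ∷ 48 ∷ 56 ∷ 64 ∷ 84 ∷ 93 ∷ 102 ∷ 114 ∷ 123 ∷ 128 ∷ 159 ∷ 163 ∷ 174 ∷ 177 ∷
  188 ∷ 192 ∷ 206 ∷ 213 ∷ 236 ∷ 247 ∷ 249 ∷ 256 ∷ 271 ∷ 286 ∷ 299 ∷ 309 ∷ 314 ∷ 320 ∷ 330 ∷ 339 ∷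
  345 ∷ 359 ∷ 372 ∷ 384 ∷ 395 ∷ 407 ∷ 417 ∷ 426 ∷ 445 ∷ 448 ∷ 460 ∷ 470 ∷ 474 ∷ 485 ∷ 489 ∷ 512 ∷
  513 ∷ 514 ∷ 515 ∷ 516 ∷ 517 ∷ 518 ∷ 519 ∷ 520 ∷ 521 ∷ 577 ∷ 614 ∷ 644 ∷ 666 ∷ 723 ∷ 747 ∷ 792 ∷
  812 ∷ 869 ∷ 887 ∷ 917 ∷ 958 ∷ 1015 ∷ 1018 ∷ [])

code74 : Code 74
code74 = listed 10 (
  8 ∷ 16 ∷ 24 ∷ 32 ∷ 40 ∷ 48 ∷ 56 ∷ 64 ∷ 84 ∷ 93 ∷ 102 ∷ 123 ∷ 128 ∷ 159 ∷ 163 ∷ 174 ∷ 177 ∷ 192 ∷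
  213 ∷ 236 ∷ 247 ∷ 249 ∷ 256 ∷ 271 ∷ 286 ∷ 309 ∷ 314 ∷ 320 ∷ 330 ∷ 339 ∷ 359 ∷ 372 ∷ 384 ∷ 395 ∷
  417 ∷ 426 ∷ 445 ∷ 448 ∷ 460 ∷ 470 ∷ 474 ∷ 489 ∷ 512 ∷ 513 ∷ 514 ∷ 515 ∷ 516 ∷ 517 ∷ 518 ∷ 519 ∷
  520 ∷ 521 ∷ 522 ∷ 577 ∷ 614 ∷ 632 ∷ 644 ∷ 666 ∷ 694 ∷ 708 ∷ 723 ∷ 747 ∷ 792 ∷ 801 ∷ 812 ∷ 851 ∷
  869 ∷ 887 ∷ 917 ∷ 925 ∷ 958 ∷ 1007 ∷ 1015 ∷ 1018 ∷ [])

-- The realised lengths, the case distinction below 60, and the theorem.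

pattern 5+_ n = suc (suc (suc (suc (suc n))))

-- The lengths 60 to 74 are fifteen consecutive values, so adding copies of `code15` reaches all
-- larger ones.
codes-60+ : ∀ d → Code (60 ℕ.+ d)
codes-60+ 0  = code15 ⊕ᶜ code15 ⊕ᶜ code15 ⊕ᶜ code15
codes-60+ 1  = code15 ⊕ᶜ code15 ⊕ᶜ code15 ⊕ᶜ code16
codes-60+ 2  = code15 ⊕ᶜ code15 ⊕ᶜ code16 ⊕ᶜ code16
codes-60+ 3  = code15 ⊕ᶜ code16 ⊕ᶜ code16 ⊕ᶜ code16
codes-60+ 4  = code16 ⊕ᶜ code16 ⊕ᶜ code16 ⊕ᶜ code16
codes-60+ 5  = code16 ⊕ᶜ code49
codes-60+ 6  = code16 ⊕ᶜ code50
codes-60+ 7  = code16 ⊕ᶜ code51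
codes-60+ 8  = code68
codes-60+ 9  = code69
codes-60+ 10 = code70
codes-60+ 11 = code71
codes-60+ 12 = code72
codes-60+ 13 = code73
codes-60+ 14 = code74
codes-60+ (5+ 5+ 5+ d) = code15 ⊕ᶜ codes-60+ d

exceptional-codes : All Code exceptionalLengths
exceptional-codes =
  code15 ∷ code16 ∷ code15 ⊕ᶜ code15 ∷ code15 ⊕ᶜ code16 ∷ code16 ⊕ᶜ code16 ∷
  code15 ⊕ᶜ code15 ⊕ᶜ code15 ∷ code15 ⊕ᶜ code15 ⊕ᶜ code16 ∷ code15 ⊕ᶜ code16 ⊕ᶜ code16 ∷
  code16 ⊕ᶜ code16 ⊕ᶜ code16 ∷ code49 ∷ code50 ∷ code51 ∷ []

-- Integer division proposes `h`, and the equation certifies that it is exact. The alternatives are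
-- the hypotheses of the two criteria.
Excluded : ℕ → ℕ → Set
Excluded n a = + 2 * h ≡ defect a n × ((h ℤ.≤ 0ℤ × h ℤ.< + excess a 0) ⊎ (0ℤ ℤ.≤ shift a n × h ℤ.< shift a n))
  where h = defect a n ℤ./ℕ 2

excluded? : ∀ n a → Dec (Excluded n a)
excluded? n a = (_ ℤ.≟ _) ×-dec (((_ ℤ.≤? _) ×-dec (_ ℤ.<? _)) ⊎-dec ((_ ℤ.≤? _) ×-dec (_ ℤ.<? _)))

excluded-sound : ∀ {n a} → 1 ≤ n → Excluded n a → ¬ Code n
excluded-sound {a = a} 1≤n (2h , inj₁ (h≤0 , h<E)) (_ , ps , code , refl) =
  Criterion.quadratic-criterion code a _ 2h h≤0 h<E
-- 1 ≤ n rules out the empty list, so there is a column to which the criterion applies.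
excluded-sound {a = a} 1≤n (2h , inj₂ (0≤s , h<s)) (_ , p ∷ ps , code , refl) =
  ℤ.<⇒≱ h<s (Criterion.point-criterion code a _ 2h 0≤s (here refl))

-- For n ≥ 1 either criterion forces s = 16 a + 8 - n ≤ 8, that is 16 a ≤ n, so only a < 4 can occur
-- below 60.
short-lengths : ∀ {n} → n ℕ.< 60 →
  n ≡ 0 ⊎ n ∈ exceptionalLengths ⊎ n ≡ 33 ⊎ n ≡ 59 ⊎ ∃ λ a → a ℕ.< 4 × Excluded n a
short-lengths = from-yes (ℕ.allUpTo? (λ n → (n ℕ.≟ 0) ⊎-dec (member? ℕ._≟_ n exceptionalLengths) ⊎-dec
  (n ℕ.≟ 33) ⊎-dec (n ℕ.≟ 59) ⊎-dec ℕ.anyUpTo? (excluded? n) 4) 60)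

no-code-33 : ¬ Code 33
no-code-33 (_ , _ , code , len) = Length33.absurd code len

no-code-59 : ¬ Code 59
no-code-59 (_ , _ , code , len) = Length59.absurd code len

lengths : ∀ {m} → 1 ≤ m → Code m → m ∈ exceptionalLengths ⊎ 60 ≤ m
lengths {m} 1≤m code with 60 ℕ.≤? m
... | yes 60≤m = inj₂ 60≤m
... | no  60≰m with short-lengths (ℕ.≰⇒> 60≰m)
...   | inj₁ refl                                      = contradiction 1≤m λ ()
...   | inj₂ (inj₁ m∈)                                 = inj₁ m∈
...   | inj₂ (inj₂ (inj₁ refl))                        = contradiction code no-code-33
...   | inj₂ (inj₂ (inj₂ (inj₁ refl)))                 = contradiction code no-code-59
...   | inj₂ (inj₂ (inj₂ (inj₂ (a , _ , excluded))))   = contradiction code (excluded-sound {a = a} 1≤m excluded)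

codes : ∀ {m} → m ∈ exceptionalLengths ⊎ 60 ≤ m → Code m
codes (inj₁ m∈)   = All.lookup exceptional-codes m∈
codes (inj₂ 60≤m) = subst Code (ℕ.m+[n∸m]≡n 60≤m) (codes-60+ _)

theorem9 : ¬ Exists8DivProjective 59
    × (∀ (m : ℕ) → 1 ≤ m → (Exists8DivProjective m ⇔ (m ∈ exceptionalLengths ⊎ 60 ≤ m)))
theorem9 = (no-code-59 ∘ fromMatrix) , λ m 1≤m → mk⇔ (lengths 1≤m ∘ fromMatrix) (toMatrix ∘ codes)
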